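{- Let $\mathcal{H}$ be a hereditary $3$-graph property, and suppose $\mathcal{H}$ is close to some slicewise stable hereditary $3$-graph property $\mathcal{H}'$. Then $\mathcal{H}$ admits binary $\mathrm{vdisc}_3$-error.
   Context: For distinct $x,y,z$ write $xy=\{x,y\}$, $xyz=\{x,y,z\}$; $K_3[X,Y,Z]=\{xyz:x\in X,y\in Y,z\in Z\text{ pairwise distinct}\}$. A $3$-graph is a pair $H=(V,F)$ with $F\subseteq\binom V3$. A hereditary $3$-graph property is a class of finite $3$-graphs closed under isomorphism and induced sub-$3$-graphs. An equipartition is a partition whose parts differ in size by at most $1$. A $3$-graph $H=(V,F)$ is slicewise $k$-stable if there do not exist $a,b_1,\dots,b_k,c_1,\dots,c_k\in V$ such that for all $i,j\in\{1,\dots,k\}$, $\{a,b_i,c_j\}\in F$ if and only if $i\leq j$. A hereditary $3$-graph property is slicewise stable if there is $k$ such that each of its members is slicewise $k$-stable. Two $3$-graphs $(V,F),(V,F')$ on the same vertex set are $\delta$-close if $|F\Delta F'|\leq\delta|V|^3$. $\mathcal{H}$ is close to $\mathcal{H}'$ if for all $\delta>0$ there is $N$ such that every $G\in\mathcal{H}$ on at least $N$ vertices is $\delta$-close to some element of $\mathcal{H}'$ with the same vertex set. A $3$-partite $3$-graph $(U\cup V\cup W,F)$ with $|F|=d|U||V||W|$ has $\mathrm{vdisc}_3(\epsilon)$ if for all $U'\subseteq U$, $V'\subseteq V$, $W'\subseteq W$, $\big||F\cap K_3[U',V',W']|-d|U'||V'||W'|\big|\leq\epsilon|U||V||W|$.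 $\mathcal{H}$ admits binary $\mathrm{vdisc}_3$-error if for all $\epsilon>0$ and $t_0\geq1$ there are $T,N$ such that for every $H=(V,F)\in\mathcal{H}$ with $|V|\geq N$ there are an equipartition $\mathcal{P}$ of $V$ into $t$ parts, $t_0\leq t\leq T$, and a set $\Sigma\subseteq\binom{\mathcal{P}}{2}$ with $|\Sigma|\leq\epsilon t^2$ such that for every three distinct parts $X,Y,Z\in\mathcal{P}$ with $XY,YZ,XZ\notin\Sigma$, the $3$-graph $(X\cup Y\cup Z,F\cap K_3[X,Y,Z])$ has $\mathrm{vdisc}_3(\epsilon)$. -}

module Defs where

open import Level using (Level; suc)
open import Data.Bool.Base using (Bool; T; _∧_; _xor_)
open import Data.Bool.Properties using () renaming (_≟_ to _≟ᵇ_)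
open import Data.Nat.Base as ℕ using (ℕ; zero; _^_)
open import Data.Integer.Base using (+_)
open import Data.Rational.Base as ℚ using (ℚ; 0ℚ; _/_; _*_; _-_)
open import Data.Fin.Base as Fin using (Fin)
open import Data.Fin.Properties using (any?) renaming (_≟_ to _≟ᶠ_)
open import Data.Fin.Subset
  using (Subset; inside; outside; ⁅_⁆; _∪_; _∩_; _∈_; _⊆_; ∣_∣; Nonempty; Empty)
open import Data.Fin.Subset.Properties using (_∈?_)
open import Data.List.Base using (List; [_]; _++_; map; length; filterᵇ)
open import Data.Vec.Base using ([]; _∷_)
open import Data.Vec.Properties using (≡-dec)
open import Data.Product.Base using (Σ-syntax; ∃-syntax; _×_)
open import Function.Bundles using (_⇔_)
open import Function.Definitions using (Injective)
open import Relation.Binary.PropositionalEquality.Core using (_≡_; _≢_)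
open import Relation.Nullary.Decidable using (Dec; ⌊_⌋; ¬?; _×-dec_)
open import Relation.Nullary.Negation.Core using (¬_)

private
  variable
    ℓ ℓ′ : Level
    m n : ℕ

⌜_⌝ : ℕ → ℚ
⌜ a ⌝ = + a / 1

Pair : Fin n → Fin n → Subset n
Pair x y = ⁅ x ⁆ ∪ ⁅ y ⁆

Triple : Fin n → Fin n → Fin n → Subset n
Triple x y z = ⁅ x ⁆ ∪ ⁅ y ⁆ ∪ ⁅ z ⁆

-- A set of subsets of Fin n, given by its characteristic function.
Family : ℕ → Set
Family n = Subset n → Bool

infix 4 _∈ᶠ_ _∉ᶠ_
_∈ᶠ_ _∉ᶠ_ : Subset n → Family n → Set
e ∈ᶠ F = T (F e)
e ∉ᶠ F = ¬ (e ∈ᶠ F)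

infixr 7 _∩ᶠ_
infixr 6 _△ᶠ_
_∩ᶠ_ _△ᶠ_ : Family n → Family n → Family n
(F ∩ᶠ G) e = F e ∧ G e
(F △ᶠ G) e = F e xor G e

subsets : ∀ n → List (Subset n)
subsets zero      = [ [] ]
subsets (ℕ.suc n) = map (inside ∷_) (subsets n) ++ map (outside ∷_) (subsets n)

card : Family n → ℕ
card {n} F = length (filterᵇ F (subsets n))

-- Sets of k-element subsets of Fin n.
record Uniform (k n : ℕ) : Set where
  field
    edges   : Family n
    uniform : ∀ e → e ∈ᶠ edges → ∣ e ∣ ≡ k

open Uniform public

-- 3-graphs with vertex set Fin n.  As every property considered is closed
-- under isomorphism, these vertex sets suffice.
ThreeGraph : ℕ → Set
ThreeGraph = Uniform 3

InK₃ : (X Y Z : Subset n) → Subset n → Set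
InK₃ X Y Z e = ∃[ x ] ∃[ y ] ∃[ z ]
  (x ∈ X × y ∈ Y × z ∈ Z) × (x ≢ y × y ≢ z × x ≢ z) × e ≡ Triple x y z

inK₃? : (X Y Z : Subset n) (e : Subset n) → Dec (InK₃ X Y Z e)
inK₃? X Y Z e = any? λ x → any? λ y → any? λ z →
  (x ∈? X ×-dec y ∈? Y ×-dec z ∈? Z) ×-dec
  (¬? (x ≟ᶠ y) ×-dec ¬? (y ≟ᶠ z) ×-dec ¬? (x ≟ᶠ z)) ×-dec
  ≡-dec _≟ᵇ_ e (Triple x y z)

K₃[_,_,_] : (X Y Z : Subset n) → Family n
K₃[ X , Y , Z ] e = ⌊ inK₃? X Y Z e ⌋

record InducedEmbedding (G : ThreeGraph m) (H : ThreeGraph n) : Set where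
  field
    to        : Fin m → Fin n
    injective : Injective _≡_ _≡_ to
    preserves : ∀ x y z →
      Triple x y z ∈ᶠ edges G ⇔ Triple (to x) (to y) (to z) ∈ᶠ edges H

Property : (ℓ : Level) → Set (suc ℓ)
Property ℓ = ∀ n → ThreeGraph n → Set ℓ

-- An induced embedding is an isomorphism onto an induced sub-3-graph, so this
-- is closure under both isomorphisms (the case m = n) and induced
-- sub-3-graphs, whose vertex sets are relabelled as initial segments.
Hereditary : Property ℓ → Set ℓ
Hereditary 𝓗 = ∀ {m n} {G : ThreeGraph m} {H : ThreeGraph n} →
  InducedEmbedding G H → 𝓗 n H → 𝓗 m G

SlicewiseStableAt : ℕ → ThreeGraph n → Set
SlicewiseStableAt {n} k H =
  ¬ (Σ[ a ∈ Fin n ] Σ[ b ∈ (Fin k → Fin n) ] Σ[ c ∈ (Fin k → Fin n) ]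
      (∀ i j → Triple a (b i) (c j) ∈ᶠ edges H ⇔ i Fin.≤ j))

SlicewiseStable : Property ℓ → Set ℓ
SlicewiseStable 𝓗 =
  ∃[ k ] (∀ {n} (H : ThreeGraph n) → 𝓗 n H → SlicewiseStableAt k H)

-- Real parameters δ, ε > 0 are taken rational here and below; this loses
-- nothing, as each condition only weakens when its parameter increases.
Close : ℚ → ThreeGraph n → ThreeGraph n → Set
Close {n} δ G G′ = ⌜ card (edges G △ᶠ edges G′) ⌝ ℚ.≤ δ * ⌜ n ^ 3 ⌝

_IsCloseTo_ : Property ℓ → Property ℓ′ → Set _
𝓗 IsCloseTo 𝓗′ = ∀ (δ : ℚ) → 0ℚ ℚ.< δ → ∃[ N ]
  (∀ {n} (G : ThreeGraph n) → 𝓗 n G → N ℕ.≤ n →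
    Σ[ G′ ∈ ThreeGraph n ] 𝓗′ n G′ × Close δ G G′)

-- For the 3-partite 3-graph (U ∪ V ∪ W , F), with U, V, W pairwise disjoint
-- and F ⊆ K₃[ U , V , W ].  The density d is determined by F unless one of
-- U, V, W is empty, in which case the condition holds for every d.
Vdisc₃ : ℚ → (U V W : Subset n) → Family n → Set
Vdisc₃ {n} ε U V W F = ∃[ d ]
  ⌜ card F ⌝ ≡ d * ⌜ ∣ U ∣ ℕ.* ∣ V ∣ ℕ.* ∣ W ∣ ⌝ ×
  (∀ (U′ V′ W′ : Subset n) → U′ ⊆ U → V′ ⊆ V → W′ ⊆ W →
    ℚ.∣ ⌜ card (F ∩ᶠ K₃[ U′ , V′ , W′ ]) ⌝ -
        d * ⌜ ∣ U′ ∣ ℕ.* ∣ V′ ∣ ℕ.* ∣ W′ ∣ ⌝ ∣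
      ℚ.≤ ε * ⌜ ∣ U ∣ ℕ.* ∣ V ∣ ℕ.* ∣ W ∣ ⌝)

record Equipartition (n t : ℕ) : Set where
  field
    part     : Fin t → Subset n
    nonempty : ∀ i → Nonempty (part i)
    disjoint : ∀ i j → i ≢ j → Empty (part i ∩ part j)
    cover    : ∀ x → ∃[ i ] x ∈ part i
    balanced : ∀ i j → ∣ part i ∣ ℕ.≤ ℕ.suc ∣ part j ∣

open Equipartition public

-- Parts are referred to by their indices in Fin t, so that a set of pairs of
-- parts is a set S of two-element subsets of Fin t.
AdmitsBinaryVdisc₃Error : Property ℓ → Set ℓ
AdmitsBinaryVdisc₃Error 𝓗 =
  ∀ (ε : ℚ) → 0ℚ ℚ.< ε → ∀ (t₀ : ℕ) → 1 ℕ.≤ t₀ →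
  ∃[ t₁ ] ∃[ N ]
  (∀ {n} (H : ThreeGraph n) → 𝓗 n H → N ℕ.≤ n →
    ∃[ t ] (t₀ ℕ.≤ t × t ℕ.≤ t₁) ×
    (Σ[ P ∈ Equipartition n t ] Σ[ S ∈ Uniform 2 t ]
      ⌜ card (edges S) ⌝ ℚ.≤ ε * ⌜ t ^ 2 ⌝ ×
      (∀ i j k → i ≢ j → j ≢ k → i ≢ k →
        Pair i j ∉ᶠ edges S → Pair j k ∉ᶠ edges S → Pair i k ∉ᶠ edges S →
        Vdisc₃ ε (part P i) (part P j) (part P k)
          (edges H ∩ᶠ K₃[ part P i , part P j , part P k ]))))

{-# OPTIONS --safe #-}

-- Write E x y z for xyz ∈ F.  In a slicewise stable 3-graph every slice E x
-- admits only binary splitting trees of bounded height (Hodges), so sets of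
-- vertices have a bounded rank, the height of a splitting tree, and whenever
-- y splits a set Z in the slice of x, the rank falls on one of the two sides
-- of Z.  The sum over all (x , z) of the rank of the cell of z in the slice
-- of x is thus a bounded potential.  Call a pair (X , Z) of parts bad if some
-- single y splits Z in the slices of many x ∈ X.  While there are many bad
-- pairs, one adds such a y for each of them to a set B, cuts the cells by the
-- neighbourhoods E b x with b ∈ B, and passes to an equipartition that is
-- nearly homogeneous for them, as exists by the same argument in the stable
-- graphs E b; the potential drops by a constant proportion of n², so few
-- rounds suffice.  If no pair in X Y Z is bad, then changing one coordinate
-- seldom changes E, so X × Y × Z has density near 0 or 1, which persists in
-- any sufficiently close 3-graph and implies vdisc₃.

module Submission where

open import Defs
open import Level using (Level)
open import Data.Product.Base using (Σ-syntax; _×_)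

open import Data.Bool.Base using (Bool; true; false; T; _∧_; _xor_; not; if_then_else_)
open import Data.Bool.Properties using (T-∧; T?) renaming (_≟_ to _≟ᵇ_)
open import Data.Empty using (⊥-elim)
open import Data.Fin.Base as Fin using (Fin; zero; suc; toℕ; fromℕ<; combine; remQuot; splitAt)
open import Data.Fin.Properties as Finₚ using (any?; all?) renaming (_≟_ to _≟ᶠ_)
open import Data.Fin.Subset using (Subset; inside; outside; ⁅_⁆; _∪_; _∈_; _⊆_; ∣_∣)
open import Data.Fin.Subset.Properties
  using (x∈p∪q⁺; x∈p∪q⁻; x∈p∩q⁻; x∈⁅x⁆; x∈⁅y⁆⇒x≡y; ∣⁅x⁆∣≡1; ∪-comm; ∪-assoc; ∪-identityˡ;
      ∪-identityʳ)
import Data.Integer.Base as ℤ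
import Data.Integer.Properties as ℤₚ
open import Data.List.Base as List using (List; []; _∷_; _++_; [_]; length; filterᵇ)
open import Data.List.Membership.Propositional.Properties using (∈-lookup)
open import Data.List.Properties using (length-++; filter-++)
open import Data.List.Relation.Unary.All as All using (All; []; _∷_)
import Data.List.Relation.Unary.All.Properties as Allₚ
open import Data.List.Relation.Unary.AllPairs using (AllPairs; []; _∷_)
import Data.List.Relation.Unary.AllPairs.Properties as AllPairsₚ
open import Data.Nat.Base as ℕ
  using (ℕ; zero; suc; _+_; _*_; _^_; _≤_; _<_; _⊓_; z≤n; s≤s; NonZero)
open import Data.Nat.DivMod using (_/_; _%_; m≡m%n+[m/n]*n; m%n<n; m/n*n≤m)
open import Data.Nat.Properties
open import Data.Nat.Tactic.RingSolver using (solve-∀)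
open import Data.Product.Base using (∃; ∃-syntax; _,_; proj₁; proj₂)
open import Data.Rational.Base as ℚ using (ℚ; mkℚ; 0ℚ; 1ℚ; toℚᵘ; ↧ₙ_)
import Data.Rational.Properties as ℚₚ
open import Data.Rational.Solver using (module +-*-Solver)
open import Data.Rational.Unnormalised.Base as ℚᵘ using (mkℚᵘ; *≡*; *≤*)
import Data.Rational.Unnormalised.Properties as ℚᵘₚ
open import Data.Sum.Base using (_⊎_; inj₁; inj₂; [_,_]′)
open import Data.Unit.Base using (tt)
open import Data.Vec.Base using ([]; _∷_; lookup; tabulate)
open import Data.Vec.Properties using (≡-dec; []=⇒lookup; lookup⇒[]=; lookup∘tabulate; ∷-injectiveʳ)
open import Function.Base using (_∘_; case_of_)
open import Function.Bundles using (_⇔_; Equivalence; mk⇔)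
open import Relation.Binary.Definitions using (tri<; tri≈; tri>)
open import Relation.Binary.PropositionalEquality
  using (_≡_; _≢_; refl; sym; trans; cong; cong₂; subst; module ≡-Reasoning)
open import Relation.Nullary.Decidable as Dec
  using (Dec; yes; no; ⌊_⌋; ¬?; _×-dec_; toWitness; fromWitness)
open import Relation.Nullary.Negation using (¬_; contradiction)
import Algebra.Properties.Semiring.Sum +-*-semiring as Sum

-- The cells vary with x, whereas the parts may not. A part Z scattered over many cells could be
-- split by y in the slice of x without any cell being split, and no rank would fall. Near
-- homogeneity for the E b with b ∈ B prevents this: for every x, almost every z lies in the main
-- cell of its part, so a y that splits the part substantially splits this cell. Since xbz = bxz,
-- cutting by E b x is splitting by the node b in the slice of x, so a vertex added to B acts in all
-- slices at once. A split is sure to lower the rank on one side only, and it is not known on which;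
-- so splits are measured by their smaller side, the minority. New parts need not lie inside old
-- ones. A vertex whose part straddles several labels may regain rank, at most K in each slice. The
-- number of parts is chosen after B, so large that this loss and the inhomogeneity together cost
-- less than a round gains. Badness lets y range over all vertices rather than over a third part,
-- hence the exceptions are pairs of parts and not triples.

private
  variable
    m m′ n p t t′ : ℕ

-- Finite sums

-- Sums are opaque in order that Agda can infer their arguments.

opaque
  ∑ : (Fin n → ℕ) → ℕ
  ∑ = Sum.sum

  ∑-cong : {f g : Fin n → ℕ} → (∀ i → f i ≡ g i) → ∑ f ≡ ∑ g
  ∑-cong = Sum.sum-cong-≗

  ∑-mono : {f g : Fin n → ℕ} → (∀ i → f i ≤ g i) → ∑ f ≤ ∑ g
  ∑-mono {zero}  f≤g = z≤n
  ∑-mono {suc n} f≤g = +-mono-≤ (f≤g zero) (∑-mono (f≤g ∘ suc))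

  ∑-const : ∀ n c → ∑ {n} (λ _ → c) ≡ n * c
  ∑-const zero    c = refl
  ∑-const (suc n) c = cong (c +_) (∑-const n c)

  ∑-+ : (f g : Fin n → ℕ) → ∑ (λ i → f i + g i) ≡ ∑ f + ∑ g
  ∑-+ = Sum.∑-distrib-+

  ∑-comm : (f : Fin m → Fin n → ℕ) → ∑ (λ i → ∑ (f i)) ≡ ∑ (λ j → ∑ (λ i → f i j))
  ∑-comm = Sum.∑-comm

  ∑-*ˡ : ∀ c (f : Fin n → ℕ) → ∑ (λ i → c * f i) ≡ c * ∑ f
  ∑-*ˡ c f = sym (Sum.*-distribˡ-sum c f)

  ∑-single : ∀ i (f : Fin n → ℕ) → (∀ j → j ≢ i → f j ≡ 0) → ∑ f ≡ f i
  ∑-single {suc n} zero    f f≡0 = trans (cong (f zero +_) (trans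
    (∑-cong {n} λ j → f≡0 (suc j) λ ()) (trans (∑-const n 0) (*-zeroʳ n)))) (+-identityʳ _)
  ∑-single {suc n} (suc i) f f≡0 = cong₂ _+_ (f≡0 zero λ ())
    (∑-single i (f ∘ suc) λ j j≢i → f≡0 (suc j) (j≢i ∘ Finₚ.suc-injective))

  ≤-∑ : (f : Fin n → ℕ) → ∀ i → f i ≤ ∑ f
  ≤-∑ f zero    = m≤m+n _ _
  ≤-∑ f (suc i) = ≤-trans (≤-∑ (f ∘ suc) i) (m≤n+m _ (f zero))

  ∑-mono-gap : ∀ {c} {f g : Fin n → ℕ} → (∀ i → f i ≤ g i) → ∀ j → f j + c ≤ g j →
    ∑ f + c ≤ ∑ g
  ∑-mono-gap {suc n} {c} {f} {g} f≤g zero gap = begin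
    f zero + ∑ (f ∘ suc) + c   ≡⟨ +-assoc (f zero) _ c ⟩
    f zero + (∑ (f ∘ suc) + c) ≡⟨ cong (f zero +_) (+-comm _ c) ⟩
    f zero + (c + ∑ (f ∘ suc)) ≡⟨ sym (+-assoc (f zero) c _) ⟩
    f zero + c + ∑ (f ∘ suc)   ≤⟨ +-mono-≤ gap (∑-mono (f≤g ∘ suc)) ⟩
    g zero + ∑ (g ∘ suc)       ∎
    where open ≤-Reasoning
  ∑-mono-gap {suc n} {c} {f} {g} f≤g (suc j) gap = begin
    f zero + ∑ (f ∘ suc) + c    ≡⟨ +-assoc (f zero) _ c ⟩
    f zero + (∑ (f ∘ suc) + c)  ≤⟨ +-mono-≤ (f≤g zero) (∑-mono-gap (f≤g ∘ suc) j gap) ⟩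
    g zero + ∑ (g ∘ suc)        ∎
    where open ≤-Reasoning

  ∑-join : ∀ a {b} (f : Fin (a + b) → ℕ) → ∑ f ≡ ∑ (λ i → f (i Fin.↑ˡ b)) + ∑ (λ i → f (a Fin.↑ʳ i))
  ∑-join zero    f = refl
  ∑-join (suc a) f = trans (cong (f zero +_) (∑-join a (f ∘ suc))) (sym (+-assoc (f zero) _ _))

  ∑-suc : (f : Fin (suc n) → ℕ) → ∑ f ≡ f zero + ∑ (f ∘ suc)
  ∑-suc f = refl

  ∑-zero : (f : Fin 0 → ℕ) → ∑ f ≡ 0
  ∑-zero f = refl

∑-bounded : ∀ {c} {f : Fin n → ℕ} → (∀ i → f i ≤ c) → ∑ f ≤ n * c
∑-bounded {n} {c} f≤c = ≤-trans (∑-mono f≤c) (≤-reflexive (∑-const n c))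

-- Indicators

𝟙 : Bool → ℕ
𝟙 true  = 1
𝟙 false = 0

𝟙≤1 : ∀ b → 𝟙 b ≤ 1
𝟙≤1 true  = ≤-refl
𝟙≤1 false = z≤n

𝟙-mono : ∀ a b → (T a → T b) → 𝟙 a ≤ 𝟙 b
𝟙-mono false b     f = z≤n
𝟙-mono true  true  f = ≤-refl
𝟙-mono true  false f = ⊥-elim (f tt)

𝟙-true : ∀ a → T a → 𝟙 a ≡ 1
𝟙-true true _ = refl

𝟙-false : ∀ a → ¬ T a → 𝟙 a ≡ 0
𝟙-false true  f = ⊥-elim (f tt)
𝟙-false false f = refl

𝟙-∧ : ∀ a b → 𝟙 (a ∧ b) ≡ 𝟙 a * 𝟙 b
𝟙-∧ true  b = sym (+-identityʳ _)
𝟙-∧ false b = refl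

T-∧⁺ : ∀ {a b} → T a → T b → T (a ∧ b)
T-∧⁺ p q = Equivalence.from T-∧ (p , q)

T-∧⁻ : ∀ a {b} → T (a ∧ b) → T a × T b
T-∧⁻ a = Equivalence.to (T-∧ {a})

T⇒≡true : ∀ {a} → T a → a ≡ true
T⇒≡true {true} _ = refl

≡true⇒T : ∀ {a} → a ≡ true → T a
≡true⇒T refl = tt

⌊⌋-intro : ∀ {a} {A : Set a} (A? : Dec A) → A → T ⌊ A? ⌋
⌊⌋-intro A? = fromWitness {a? = A?}

⌊⌋-elim : ∀ {a} {A : Set a} (A? : Dec A) → T ⌊ A? ⌋ → A
⌊⌋-elim A? = toWitness {a? = A?}

infix 4 _⊑_
_⊑_ : (Fin n → Bool) → (Fin n → Bool) → Set
Z ⊑ Z′ = ∀ z → T (Z z) → T (Z′ z)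

opaque
  ∫ : (Fin n → Bool) → (Fin n → ℕ) → ℕ
  ∫ Z f = ∑ λ z → 𝟙 (Z z) * f z

  ∫-def : (Z : Fin n → Bool) (f : Fin n → ℕ) → ∫ Z f ≡ ∑ λ z → 𝟙 (Z z) * f z
  ∫-def Z f = refl

  count : (Fin n → Bool) → ℕ
  count Z = ∑ (𝟙 ∘ Z)

  count-def : (Z : Fin n → Bool) → count Z ≡ ∑ (𝟙 ∘ Z)
  count-def Z = refl

  count-mono : {Z Z′ : Fin n → Bool} → Z ⊑ Z′ → count Z ≤ count Z′
  count-mono {Z = Z} {Z′} Z⊑Z′ = ∑-mono λ z → 𝟙-mono (Z z) (Z′ z) (Z⊑Z′ z)

  ∫-mono : {Z : Fin n → Bool} {f g : Fin n → ℕ} → (∀ z → T (Z z) → f z ≤ g z) → ∫ Z f ≤ ∫ Z g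
  ∫-mono {Z = Z} {f} {g} f≤g = ∑-mono λ z → go (Z z) (f≤g z)
    where
    go : ∀ b {x y} → (T b → x ≤ y) → 𝟙 b * x ≤ 𝟙 b * y
    go true  h = *-monoʳ-≤ 1 (h tt)
    go false h = z≤n

  ∫-cong : {Z : Fin n → Bool} {f g : Fin n → ℕ} → (∀ z → f z ≡ g z) → ∫ Z f ≡ ∫ Z g
  ∫-cong {Z = Z} f≡g = ∑-cong λ z → cong (𝟙 (Z z) *_) (f≡g z)

  ∫-+ : (Z : Fin n → Bool) (f g : Fin n → ℕ) → ∫ Z (λ z → f z + g z) ≡ ∫ Z f + ∫ Z g
  ∫-+ Z f g = trans (∑-cong λ z → *-distribˡ-+ (𝟙 (Z z)) (f z) (g z)) (∑-+ (λ z → 𝟙 (Z z) * f z) _)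

  ∫-*ˡ : (Z : Fin n → Bool) (c : ℕ) (f : Fin n → ℕ) → ∫ Z (λ z → c * f z) ≡ c * ∫ Z f
  ∫-*ˡ Z c f = trans (∑-cong λ z → lemma (𝟙 (Z z)) c (f z)) (∑-*ˡ c (λ z → 𝟙 (Z z) * f z))
    where
    lemma : ∀ a c x → a * (c * x) ≡ c * (a * x)
    lemma = solve-∀

  ∫-const : (Z : Fin n → Bool) (c : ℕ) → ∫ Z (λ _ → c) ≡ count Z * c
  ∫-const Z c = trans (∑-cong λ z → *-comm (𝟙 (Z z)) c)
    (trans (∑-*ˡ c (𝟙 ∘ Z)) (*-comm c _))

  ∫-∑ : (Z : Fin n → Bool) (f : Fin n → Fin m → ℕ) → ∫ Z (λ z → ∑ (f z)) ≡ ∑ λ i → ∫ Z (λ z → f z i)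
  ∫-∑ Z f = trans (∑-cong λ z → sym (∑-*ˡ (𝟙 (Z z)) (f z))) (∑-comm λ z i → 𝟙 (Z z) * f z i)

  ∫-comm : (X : Fin n → Bool) (Y : Fin m → Bool) (f : Fin n → Fin m → ℕ) →
    ∫ X (λ x → ∫ Y (f x)) ≡ ∫ Y (λ y → ∫ X (λ x → f x y))
  ∫-comm X Y f = trans (∫-∑ X λ x y → 𝟙 (Y y) * f x y) (∑-cong λ y → ∫-*ˡ X (𝟙 (Y y)) (λ x → f x y))

  ∃-of-count : (Z : Fin n → Bool) → 1 ≤ count Z → ∃[ z ] T (Z z)
  ∃-of-count {zero}  Z h = ⊥-elim (<-irrefl refl (≤-trans h (≤-reflexive (∑-zero (𝟙 ∘ Z)))))
  ∃-of-count {suc n} Z h with Z zero in eq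
  ... | true  = zero , ≡true⇒T eq
  ... | false = let z , p = ∃-of-count (Z ∘ suc) (≤-trans h (≤-reflexive
                      (trans (∑-suc (𝟙 ∘ Z)) (cong (λ b → 𝟙 b + ∑ (𝟙 ∘ Z ∘ suc)) eq))))
                in suc z , p

∫-*ʳ : (Z : Fin n → Bool) (f : Fin n → ℕ) (c : ℕ) → ∫ Z (λ z → f z * c) ≡ ∫ Z f * c
∫-*ʳ Z f c = trans (∫-cong λ z → *-comm (f z) c) (trans (∫-*ˡ Z c f) (*-comm c _))

fibre : (Fin n → Fin t) → Fin t → Fin n → Bool
fibre P j z = ⌊ P z ≟ᶠ j ⌋

∑-fibres : (P : Fin n → Fin t) (f : Fin n → ℕ) → ∑ f ≡ ∑ λ i → ∫ (fibre P i) f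
∑-fibres P f = sym (trans (∑-cong λ i → ∫-def (fibre P i) f)
  (trans (sym (∑-comm λ z i → 𝟙 (fibre P i z) * f z)) (∑-cong λ z →
    trans (∑-single (P z) (λ i → 𝟙 (fibre P i z) * f z)
            (λ i i≢ → cong (_* f z) (𝟙-false (fibre P i z) λ e → i≢ (sym (⌊⌋-elim (P z ≟ᶠ i) e)))))
          (trans (cong (_* f z) (𝟙-true (fibre P (P z) z) (⌊⌋-intro (P z ≟ᶠ P z) refl)))
              (*-identityˡ _)))))

-- Binary splitting trees and Hodges' lemma

side : (Fin n → Bool) → Bool → Fin n → Bool
side g s z = ⌊ g z ≟ᵇ s ⌋

infixl 7 _⊓ˢ_
_⊓ˢ_ : (Fin n → Bool) → (Fin n → Bool) → Fin n → Bool
(Z ⊓ˢ Z′) z = Z z ∧ Z′ z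

full : Fin n → Bool
full _ = true

⊓ˢ-mono : ∀ {Z Z′} (W : Fin n → Bool) → Z ⊑ Z′ → Z ⊓ˢ W ⊑ Z′ ⊓ˢ W
⊓ˢ-mono {Z = Z} W sub z p = let a , b = T-∧⁻ (Z z) p in T-∧⁺ (sub z a) b

⊓ˢ⊑ : ∀ (Z W : Fin n → Bool) → Z ⊓ˢ W ⊑ Z
⊓ˢ⊑ Z W z p = proj₁ (T-∧⁻ (Z z) p)

-- Inner nodes are vertices y in C, which split Z by G y; leaves lie in Z.
Tree : (Fin m → Fin n → Bool) → (Fin m → Bool) → ℕ → (Fin n → Bool) → Set
Tree G C zero    Z = ∃[ z ] T (Z z)
Tree G C (suc r) Z = ∃[ y ] T (C y) ×
  Tree G C r (Z ⊓ˢ side (G y) true) × Tree G C r (Z ⊓ˢ side (G y) false)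

-- The step from h to 2h + 2 is what `Tree⇒Ladder` consumes: one level for the root, then height
-- `suc h + h` for `Tree-ramsey`. The unequal summands arise because in one of its two cases the
-- root of the subtree found becomes a rung.
treeHeight : ℕ → ℕ
treeHeight zero    = 0
treeHeight (suc k) = suc (suc (treeHeight k) + treeHeight k)

module _ (G : Fin m → Fin n → Bool) where

  Tree-mono : ∀ {C} r {Z Z′} → Z ⊑ Z′ → Tree G C r Z → Tree G C r Z′
  Tree-mono zero    sub (z , p) = z , sub z p
  Tree-mono (suc r) sub (y , c , t , f) =
    y , c , Tree-mono r (⊓ˢ-mono (side (G y) true) sub) t , Tree-mono r
        (⊓ˢ-mono (side (G y) false) sub) f

  Tree? : ∀ C r Z → Dec (Tree G C r Z)
  Tree? C zero    Z = any? λ z → T? (Z z)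
  Tree? C (suc r) Z = any? λ y → T? (C y) ×-dec
    Tree? C r (Z ⊓ˢ side (G y) true) ×-dec Tree? C r (Z ⊓ˢ side (G y) false)

  leaf : ∀ {C} r {Z} → Tree G C r Z → ∃[ z ] T (Z z)
  leaf zero    t = t
  leaf (suc r) {Z} (y , _ , t , _) = let z , p = leaf r t in z , ⊓ˢ⊑ Z (side (G y) true) z p

  -- Induction on both heights. If the root satisfies φ, either both subtrees yield a φ-tree of
  -- height p - 1, which the root joins, or one of them already yields a tree of the other kind;
  -- symmetrically if it does not. Skipping the root only enlarges the set that has to contain the
  -- leaves.
  Tree-ramsey : ∀ φ {C} p q {Z} → Tree G C (p + q) Z →
    Tree G (C ⊓ˢ side φ true) p Z ⊎ Tree G (C ⊓ˢ side φ false) q Z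
  Tree-ramsey φ {C} zero q t = inj₁ (leaf q t)
  Tree-ramsey φ {C} (suc p) zero t = inj₂ (leaf (suc (p + 0)) t)
  Tree-ramsey φ {C} (suc p) (suc q) {Z} (y , c , t , f) with φ y in eq
  ... | true with Tree-ramsey φ p (suc q) t | Tree-ramsey φ p (suc q) f
  ...   | inj₂ t′ | _       = inj₂ (Tree-mono (suc q) (⊓ˢ⊑ Z (side (G y) true)) t′)
  ...   | inj₁ _  | inj₂ f′ = inj₂ (Tree-mono (suc q) (⊓ˢ⊑ Z (side (G y) false)) f′)
  ...   | inj₁ t′ | inj₁ f′ = inj₁ (y , T-∧⁺ c (⌊⌋-intro (φ y ≟ᵇ true) eq) , t′ , f′)
  Tree-ramsey φ {C} (suc p) (suc q) {Z} (y , c , t , f) | false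
    with Tree-ramsey φ (suc p) q (subst (λ r → Tree G C r (Z ⊓ˢ side (G y) true)) (+-suc p q) t)
       | Tree-ramsey φ (suc p) q (subst (λ r → Tree G C r (Z ⊓ˢ side (G y) false)) (+-suc p q) f)
  ...   | inj₁ t′ | _       = inj₁ (Tree-mono (suc p) (⊓ˢ⊑ Z (side (G y) true)) t′)
  ...   | inj₂ _  | inj₁ f′ = inj₁ (Tree-mono (suc p) (⊓ˢ⊑ Z (side (G y) false)) f′)
  ...   | inj₂ t′ | inj₂ f′ = inj₂ (y , T-∧⁺ c (⌊⌋-intro (φ y ≟ᵇ false) eq) , t′ , f′)

  infix 4 _⊲_
  _⊲_ : Fin m × Fin n → Fin m × Fin n → Set
  (b , c) ⊲ (b′ , c′) = T (G b c′) × ¬ T (G b′ c)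

  -- A half-graph as a list, so that it can grow at either end; `C` and `Z` confine the rungs, which
  -- is how a new outermost rung is compared with all of them.
  record Ladder (C : Fin m → Bool) (Z : Fin n → Bool) (k : ℕ) : Set where
    field
      rungs  : List (Fin m × Fin n)
      size   : length rungs ≡ k
      within : All (λ (b , c) → T (C b) × T (Z c)) rungs
      diag   : All (λ (b , c) → T (G b c)) rungs
      ladder : AllPairs _⊲_ rungs

  ladder-∷ : ∀ {C Z k} φ a c → T (C a) → T (Z c) → T (G a c) →
    (∀ b → T (φ b) → ¬ T (G b c)) →
    Ladder (C ⊓ˢ φ) (Z ⊓ˢ side (G a) true) k → Ladder C Z (suc k)
  ladder-∷ {C} {Z} φ a c Ca Zc Gac h L = record
    { rungs  = (a , c) ∷ rungs
    ; size   = cong suc size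
    ; within = (Ca , Zc) ∷ All.map (λ {x} (p , q) → proj₁ (T-∧⁻ (C (proj₁ x)) p) , proj₁
        (T-∧⁻ (Z (proj₂ x)) q)) within
    ; diag   = Gac ∷ diag
    ; ladder = All.map (λ {x} (p , q) →
        ≡true⇒T (⌊⌋-elim (_ ≟ᵇ true) (proj₂ (T-∧⁻ (Z (proj₂ x)) q))) ,
        h (proj₁ x) (proj₂ (T-∧⁻ (C (proj₁ x)) p))) within ∷ ladder
    }
    where open Ladder L

  ladder-∷ʳ : ∀ {C Z k} φ b c → T (C b) → T (Z c) → T (G b c) →
    (∀ b → T (φ b) → T (G b c)) →
    Ladder (C ⊓ˢ φ) (Z ⊓ˢ side (G b) false) k → Ladder C Z (suc k)
  ladder-∷ʳ {C} {Z} φ b c Cb Zc Gbc h L = record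
    { rungs  = rungs ++ [ b , c ]
    ; size   = trans (length-++ rungs) (trans (+-comm _ 1) (cong suc size))
    ; within = Allₚ.++⁺ (All.map (λ {x} (p , q) → proj₁ (T-∧⁻ (C (proj₁ x)) p) , proj₁
        (T-∧⁻ (Z (proj₂ x)) q)) within) ((Cb , Zc) ∷ [])
    ; diag   = Allₚ.++⁺ diag (Gbc ∷ [])
    ; ladder = AllPairsₚ.++⁺ ladder ([] ∷ []) (All.map (λ {x} (p , q) →
        (h (proj₁ x) (proj₂ (T-∧⁻ (C (proj₁ x)) p)) ,
         λ t → case trans (sym (T⇒≡true t)) (⌊⌋-elim (_ ≟ᵇ false) (proj₂ (T-∧⁻ (Z (proj₂ x)) q)))
             of λ ()) ∷ []) within)
    }
    where open Ladder L

  -- Each step adds an outermost rung: at the front if the vertices of a large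
  -- subtree below the root avoid a leaf c, at the back if they are all
  -- joined to c.
  Tree⇒Ladder : ∀ k {C Z} → Tree G C (treeHeight k) Z → Ladder C Z k
  Tree⇒Ladder zero    t = record { rungs = [] ; size = refl ; within = [] ; diag = [] ; ladder =
      [] }
  Tree⇒Ladder (suc k) {C} {Z} (a , Ca , t , _)
    with leaf (suc (treeHeight k) + treeHeight k) t
  ... | c , Zc′ with T-∧⁻ (Z c) Zc′
  ... | Zc , Gac with Tree-ramsey (λ b → G b c) (suc (treeHeight k)) (treeHeight k) t
  ... | inj₂ t′ = ladder-∷ (side (λ b → G b c) false) a c Ca Zc (≡true⇒T (⌊⌋-elim (_ ≟ᵇ true) Gac))
        (λ b p q → case trans (sym (T⇒≡true q)) (⌊⌋-elim (_ ≟ᵇ false) p) of λ ())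
        (Tree⇒Ladder k t′)
  ... | inj₁ (b , Cb , _ , f) = ladder-∷ʳ (side (λ b → G b c) true) b c (proj₁ (T-∧⁻ (C b) Cb)) Zc
        (≡true⇒T (⌊⌋-elim (_ ≟ᵇ true) (proj₂ (T-∧⁻ (C b) Cb))))
        (λ b p → ≡true⇒T (⌊⌋-elim (_ ≟ᵇ true) p))
        (Tree⇒Ladder k (Tree-mono (treeHeight k) (⊓ˢ-mono (side (G b) false)
            (⊓ˢ⊑ Z (side (G a) true))) f))

AllPairs-lookup : ∀ {a r} {A : Set a} {R : A → A → Set r} {xs} → AllPairs R xs →
  ∀ i j → i Fin.< j → R (List.lookup xs i) (List.lookup xs j)
AllPairs-lookup (px ∷ _)  zero    (suc j) _         = All.lookup px (∈-lookup j)
AllPairs-lookup (_ ∷ pxs) (suc i) (suc j) (s≤s i<j) = AllPairs-lookup pxs i j i<j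

HasHalfGraph : ∀ k → (Fin m → Fin n → Bool) → Set
HasHalfGraph {m} {n} k G = Σ[ b ∈ (Fin k → Fin m) ] Σ[ c ∈ (Fin k → Fin n) ]
  (∀ i j → T (G (b i) (c j)) ⇔ i Fin.≤ j)

Ladder⇒HalfGraph : ∀ {k} {G : Fin m → Fin n → Bool} {C Z} → Ladder G C Z k → HasHalfGraph k G
Ladder⇒HalfGraph {G = G} L@record { size = refl } = (λ i → proj₁ (List.lookup rungs i)) ,
    (λ i → proj₂ (List.lookup rungs i)) , λ i j → mk⇔ (to i j) (from i j)
  where
  open Ladder L
  to : ∀ i j → T (G (proj₁ (List.lookup rungs i)) (proj₂ (List.lookup rungs j))) → i Fin.≤ j
  to i j p with Finₚ.<-cmp i j
  ... | tri< i<j _ _ = <⇒≤ i<j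
  ... | tri≈ _ refl _ = ≤-refl
  ... | tri> _ _ j<i = contradiction p (proj₂ (AllPairs-lookup ladder j i j<i))
  from : ∀ i j → i Fin.≤ j → T (G (proj₁ (List.lookup rungs i)) (proj₂ (List.lookup rungs j)))
  from i j i≤j with Finₚ.<-cmp i j
  ... | tri< i<j _ _ = proj₁ (AllPairs-lookup ladder i j i<j)
  ... | tri≈ _ refl _ = All.lookup diag (∈-lookup i)
  ... | tri> _ _ j<i = contradiction i≤j (<⇒≱ j<i)

-- Ranks and minorities

module Rank (G : Fin m → Fin n → Bool) where

  -- Shelah's 2-rank, truncated at K and counted from rank ∅ = 0.
  rank : ℕ → (Fin n → Bool) → ℕ
  rank zero    Z = 0
  rank (suc K) Z = 𝟙 ⌊ Tree? G full K Z ⌋ + rank K Z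

  rank-mono : ∀ K {Z Z′} → Z ⊑ Z′ → rank K Z ≤ rank K Z′
  rank-mono zero    sub = z≤n
  rank-mono (suc K) {Z} {Z′} sub = +-mono-≤
    (𝟙-mono _ _ λ t → ⌊⌋-intro (Tree? G full K Z′)
        (Tree-mono G K sub (⌊⌋-elim (Tree? G full K Z) t)))
    (rank-mono K sub)

  rank≤ : ∀ K Z → rank K Z ≤ K
  rank≤ zero    Z = z≤n
  rank≤ (suc K) Z = +-mono-≤ (𝟙≤1 _) (rank≤ K Z)

  -- Let r be the largest height of a tree in Z. If both sides contained trees of height r, the root
  -- y would join them to one of height r + 1. So on one side the indicator of height r vanishes,
  -- while all others are monotone. The absence of a tree of height K means that the truncation
  -- hides nothing.
  rank-drop : ∀ K {Z} → ¬ Tree G full K Z → ∃[ z ] T (Z z) → ∀ y →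
    ∃[ s ] rank K (Z ⊓ˢ side (G y) s) < rank K Z
  rank-drop zero    noTree inh y = contradiction inh noTree
  rank-drop (suc K) {Z} noTree inh y with Tree? G full K Z
  ... | no noTree′ = let s , lt = rank-drop K noTree′ inh y in s ,
    <-≤-trans (+-mono-≤-< (≤-reflexive (𝟙-false _ λ t →
      noTree′ (Tree-mono G K (⊓ˢ⊑ Z _) (⌊⌋-elim (Tree? G full K (Z ⊓ˢ side (G y) s)) t)))) lt)
          ≤-refl
  ... | yes tree with Tree? G full K (Z ⊓ˢ side (G y) true)
  ...   | no  noT = true , s≤s (≤-trans (+-monoˡ-≤ _ (≤-reflexive (𝟙-false _ λ t →
            noT (⌊⌋-elim (Tree? G full K (Z ⊓ˢ side (G y) true)) t)))) (rank-mono K (⊓ˢ⊑ Z _)))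
  ...   | yes t = false , s≤s (≤-trans (+-monoˡ-≤ _ (≤-reflexive (𝟙-false _ λ f →
            noTree (y , tt , t , ⌊⌋-elim (Tree? G full K (Z ⊓ˢ side (G y) false)) f))))
                (rank-mono K (⊓ˢ⊑ Z _)))

minority : (Fin n → Bool) → (Fin n → Bool) → ℕ
minority Z g = count (Z ⊓ˢ side g true) ⊓ count (Z ⊓ˢ side g false)

minority≤ : (Z g : Fin n → Bool) → ∀ s → minority Z g ≤ count (Z ⊓ˢ side g s)
minority≤ Z g true  = m⊓n≤m _ _
minority≤ Z g false = m⊓n≤n (count (Z ⊓ˢ side g true)) _

majority : (Fin n → Bool) → (Fin n → Bool) → Bool
majority Z g = ⌊ count (Z ⊓ˢ side g false) ≤? count (Z ⊓ˢ side g true) ⌋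

count-minority : (Z g : Fin n → Bool) → count (Z ⊓ˢ side g (not (majority Z g))) ≡ minority Z g
count-minority Z g with count (Z ⊓ˢ side g false) ≤? count (Z ⊓ˢ side g true)
... | yes le = sym (m≥n⇒m⊓n≡n le)
... | no  gt = sym (m≤n⇒m⊓n≡m (<⇒≤ (≰⇒> gt)))

module Drop (G : Fin m → Fin n → Bool) (K : ℕ) (noTree : ¬ Tree G full K full) where

  open Rank G

  rankSum : (Fin n → Fin n → Bool) → ℕ
  rankSum cell = ∑ λ z → rank K (cell z)

  module _ (old new : Fin n → Fin n → Bool) where

    dropped : Fin n → Bool
    dropped z = ⌊ rank K (new z) <? rank K (old z) ⌋

    rankSum-dropped : (∀ z → new z ⊑ old z) → rankSum new + ∑ (𝟙 ∘ dropped) ≤ rankSum old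
    rankSum-dropped sub = ≤-trans (≤-reflexive (sym (∑-+ _ (𝟙 ∘ dropped)))) (∑-mono pointwise)
      where
      pointwise : ∀ z → rank K (new z) + 𝟙 (dropped z) ≤ rank K (old z)
      pointwise z with rank K (new z) <? rank K (old z)
      ... | yes lt = ≤-trans (≤-reflexive (+-comm _ 1)) lt
      ... | no  _  = ≤-trans (≤-reflexive (+-identityʳ _)) (rank-mono K (sub z))

    -- On the side of N given by `rank-drop`, every vertex moves from a cell of rank at least that
    -- of N to one of smaller rank. The minority bounds either side from below, so it does not
    -- matter which one this is.
    minority≤dropped : ∀ N y → (∀ z → T (N z) → N ⊑ old z) →
      (∀ z → T (N z) → new z ⊑ N ⊓ˢ side (G y) (G y z)) →
      minority N (G y) ≤ ∫ N (𝟙 ∘ dropped)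
    minority≤dropped N y N⊑old new⊑ with any? (λ z → T? (N z))
    ... | no empty = ≤-trans (minority≤ N (G y) true) (≤-trans (≤-reflexive (count-def _))
            (≤-trans (∑-bounded {c = 0} λ z → ≤-reflexive
                (𝟙-false _ λ p → empty (z , proj₁ (T-∧⁻ (N z) p))))
              (≤-trans (≤-reflexive (*-zeroʳ n)) z≤n)))
    ... | yes inh with rank-drop K (noTree ∘ Tree-mono G K (λ _ _ → tt)) inh y
    ...   | s , lt = begin
      minority N (G y)                 ≤⟨ minority≤ N (G y) s ⟩
      count (N ⊓ˢ side (G y) s)        ≡⟨ count-def _ ⟩
      ∑ (𝟙 ∘ (N ⊓ˢ side (G y) s))      ≤⟨ ∑-mono (λ z → ≤-trans
          (𝟙-mono _ (N z ∧ dropped z) (drops z)) (≤-reflexive (𝟙-∧ (N z) _))) ⟩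
      ∑ (λ z → 𝟙 (N z) * 𝟙 (dropped z)) ≡⟨ ∫-def N _ ⟨
      ∫ N (𝟙 ∘ dropped)                ∎
      where
      open ≤-Reasoning
      drops : ∀ z → T ((N ⊓ˢ side (G y) s) z) → T (N z ∧ dropped z)
      drops z p with T-∧⁻ (N z) p
      ... | Nz , q = T-∧⁺ Nz (⌊⌋-intro (_ <? _) (begin-strict
        rank K (new z)                         ≤⟨ rank-mono K (new⊑ z Nz) ⟩
        rank K (N ⊓ˢ side (G y) (G y z))       ≡⟨ cong (λ b → rank K (N ⊓ˢ side (G y) b))
            (⌊⌋-elim (G y z ≟ᵇ s) q) ⟩
        rank K (N ⊓ˢ side (G y) s)             <⟨ lt ⟩
        rank K N                               ≤⟨ rank-mono K (N⊑old z Nz) ⟩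
        rank K (old z)                         ∎))

-- Regular partitions of stable graphs

-- The Hamming distance from g to the nearest union of parts.
mass : (Fin n → Fin t) → (Fin n → Bool) → ℕ
mass P g = ∑ λ j → minority (fibre P j) g

Refines : (Fin n → Fin t′) → (Fin n → Fin t) → Set
Refines R′ R = ∀ z z′ → R′ z ≡ R′ z′ → R z ≡ R z′

split : (Fin n → Fin t) → (Fin n → Bool) → Fin n → Fin (t * 2)
split R g z = combine (R z) (if g z then suc zero else zero)

split-≡ : ∀ (R : Fin n → Fin t) g z z′ → split R g z ≡ split R g z′ → R z ≡ R z′ × g z ≡ g z′
split-≡ R g z z′ e with Finₚ.combine-injective (R z) _ (R z′) _ e
... | e₁ , e₂ = e₁ , bit (g z) (g z′) e₂
  where
  bit : ∀ a b → (if a then suc zero else zero {n = 1}) ≡ (if b then suc zero else zero) → a ≡ b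
  bit true  true  _ = refl
  bit false false _ = refl
  bit true  false ()
  bit false true  ()

-- Several graphs share one partition, because the same parts must suit E b for all b ∈ B.
module GraphRegularity (G : Fin p → Fin m → Fin n → Bool) (K : ℕ)
  (noTree : ∀ l → ¬ Tree (G l) full K full) where

  cell : (Fin n → Fin t) → Fin n → Fin n → Bool
  cell R z = fibre R (R z)

  potential : (Fin n → Fin t) → ℕ
  potential R = ∑ λ l → Drop.rankSum (G l) K (noTree l) (cell R)

  potential≤ : (R : Fin n → Fin t) → potential R ≤ p * K * n
  potential≤ R = ≤-trans (∑-bounded λ l → ∑-bounded λ z → Rank.rank≤ (G l) K (cell R z))
    (≤-reflexive (trans (cong (p *_) (*-comm n K)) (sym (*-assoc p K n))))

  split-cell : (R : Fin n → Fin t) (g : Fin n → Bool) → ∀ z → cell (split R g) z ⊑ cell R z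
  split-cell R g z z′ e = ⌊⌋-intro (R z′ ≟ᶠ R z)
    (proj₁ (split-≡ R g z′ z (⌊⌋-elim (split R g z′ ≟ᶠ split R g z) e)))

  mass≤dropped : (R : Fin n → Fin t) → ∀ l y →
    mass R (G l y) ≤ ∑ (𝟙 ∘ Drop.dropped (G l) K (noTree l) (cell R) (cell (split R (G l y))))
  mass≤dropped R l y = ≤-trans
    (∑-mono λ j → Drop.minority≤dropped (G l) K (noTree l) (cell R) (cell R′) (fibre R j) y
      (λ z Nz z′ Nz′ → ⌊⌋-intro (R z′ ≟ᶠ R z)
        (trans (⌊⌋-elim (R z′ ≟ᶠ j) Nz′) (sym (⌊⌋-elim (R z ≟ᶠ j) Nz))))
      (λ z Nz z′ e → let e₁ , e₂ = split-≡ R (G l y) z′ z (⌊⌋-elim (R′ z′ ≟ᶠ R′ z) e) in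
        T-∧⁺ (⌊⌋-intro (R z′ ≟ᶠ j) (trans e₁ (⌊⌋-elim (R z ≟ᶠ j) Nz)))
             (⌊⌋-intro (G l y z′ ≟ᵇ G l y z) e₂)))
    (≤-reflexive (sym (∑-fibres R _)))
    where
    R′ = split R (G l y)

  -- The ranks in graph l pay for the mass; in the other graphs the cells only shrink, so no rank
  -- rises.
  potential-drop : (R : Fin n → Fin t) → ∀ l y →
    potential (split R (G l y)) + mass R (G l y) ≤ potential R
  potential-drop R l y = ∑-mono-gap
    (λ l′ → ∑-mono λ z → Rank.rank-mono (G l′) K (split-cell R (G l y) z)) l
    (≤-trans (+-monoʳ-≤ _ (mass≤dropped R l y))
      (Drop.rankSum-dropped (G l) K (noTree l) _ _ (split-cell R (G l y))))

  Regular : ℕ → (Fin n → Fin t) → Set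
  Regular h R = ∀ l y → h * mass R (G l y) ≤ n

  regularise : ∀ h f {t} (R : Fin n → Fin t) → h * potential R ≤ f * n →
    ∃[ t′ ] Σ[ R′ ∈ (Fin n → Fin t′) ] t′ ≤ 2 ^ f * t × Refines R′ R × Regular h R′
  regularise h f {t} R pot≤ with any? (λ l → any? (λ y → n <? h * mass R (G l y)))
  ... | no regular = t , R , m≤n*m t (2 ^ f) {{m^n≢0 2 f}} , (λ _ _ e → e) ,
        λ l y → ≮⇒≥ λ lt → regular (l , y , lt)
  ... | yes (l , y , lt) = continue f (begin-strict
      h * potential R′ + n                     <⟨ +-monoʳ-< _ lt ⟩
      h * potential R′ + h * mass R (G l y)    ≡⟨ *-distribˡ-+ h _ _ ⟨
      h * (potential R′ + mass R (G l y))      ≤⟨ *-monoʳ-≤ h (potential-drop R l y) ⟩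
      h * potential R                          ≤⟨ pot≤ ⟩
      f * n                                    ∎)
    where
    open ≤-Reasoning
    R′ = split R (G l y)
    continue : ∀ f → h * potential R′ + n < f * n →
      ∃[ t′ ] Σ[ R″ ∈ (Fin n → Fin t′) ] t′ ≤ 2 ^ f * t × Refines R″ R × Regular h R″
    continue zero    ()
    continue (suc f) lt with regularise h f R′ (+-cancelʳ-≤ n _ _
        (≤-trans (<⇒≤ lt) (≤-reflexive (+-comm n _))))
    ... | t″ , R″ , le , ref , reg = t″ , R″ , ≤-trans le (≤-reflexive (lemma (2 ^ f) t)) ,
          (λ z z′ e → proj₁ (split-≡ R (G l y) z z′ (ref z z′ e))) , reg
      where
      lemma : ∀ a t → a * (t * 2) ≡ 2 * a * t
      lemma = solve-∀

count≤∫ : {Z Z′ : Fin n → Bool} (f : Fin n → ℕ) → (∀ z → T (Z z) → T (Z′ z) × 1 ≤ f z) →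
  count Z ≤ ∫ Z′ f
count≤∫ {Z = Z} {Z′} f h = ≤-trans (≤-reflexive (count-def Z))
  (≤-trans (∑-mono pointwise) (≤-reflexive (sym (∫-def Z′ f))))
  where
  pointwise : ∀ z → 𝟙 (Z z) ≤ 𝟙 (Z′ z) * f z
  pointwise z with Z z | h z
  ... | false | _  = z≤n
  ... | true  | h′ = let Z′z , le = h′ tt in
    ≤-trans le (≤-reflexive (sym (trans (cong (_* f z) (𝟙-true (Z′ z) Z′z)) (*-identityˡ _))))

-- The right-hand side counts the vertices on the minority side of their R-part, and those in
-- `left`. A part of P with a vertex outside `left` lies in a single R-part, whose majority can be
-- taken for its own; any other part consists of vertices of `left`.
mass-aligned : (P : Fin n → Fin t) (R : Fin n → Fin t′) (left : Fin n → Bool) →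
  (∀ z → T (left z) ⊎ (∀ z′ → P z′ ≡ P z → R z′ ≡ R z)) →
  ∀ g → mass P g ≤ mass R g + count left
mass-aligned P R left aligned g = begin
  mass P g                                                            ≤⟨ ∑-mono perPart ⟩
  ∑ (λ j → ∫ (fibre P j) λ z → 𝟙 (deviates z) + 𝟙 (left z))           ≡⟨ ∑-fibres P _ ⟨
  ∑ (λ z → 𝟙 (deviates z) + 𝟙 (left z))                               ≡⟨ ∑-+ _ _ ⟩
  ∑ (𝟙 ∘ deviates) + ∑ (𝟙 ∘ left)                                     ≡⟨ cong₂ _+_ deviation
      (count-def left) ⟨
  mass R g + count left                                               ∎
  where
  open ≤-Reasoning
  maj : Fin _ → Bool
  maj i = majority (fibre R i) g
  deviates : Fin _ → Bool
  deviates z = side g (not (maj (R z))) z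
  deviation : mass R g ≡ ∑ (𝟙 ∘ deviates)
  deviation = sym (trans (∑-fibres R (𝟙 ∘ deviates)) (∑-cong λ i → trans (∫-def (fibre R i) _)
    (trans (∑-cong (perVertex i)) (trans (sym (count-def _)) (count-minority (fibre R i) g)))))
    where
    perVertex : ∀ i z → 𝟙 (fibre R i z) * 𝟙 (deviates z) ≡ 𝟙 ((fibre R i ⊓ˢ side g (not (maj i))) z)
    perVertex i z with R z ≟ᶠ i
    ... | yes refl = *-identityˡ _
    ... | no  _    = refl
  perPart : ∀ j → minority (fibre P j) g ≤ ∫ (fibre P j) λ z → 𝟙 (deviates z) + 𝟙 (left z)
  perPart j with any? (λ z → T? (fibre P j z) ×-dec ¬? (T? (left z)))
  ... | no none = ≤-trans (minority≤ (fibre P j) g true) (count≤∫ _ λ z p →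
        let Pz = proj₁ (T-∧⁻ (fibre P j z) p) in Pz ,
        [ (λ l → m≤n⇒m≤o+n _ (≤-reflexive (sym (𝟙-true (left z) l)))) ,
            (λ nl → contradiction (z , Pz , nl) none) ]′ (Dec.toSum (T? (left z))))
  ... | yes (z₀ , Pz₀ , notLeft) = ≤-trans (minority≤ (fibre P j) g (not (maj (R z₀))))
      (count≤∫ _ λ z p →
        let Pz , q = T-∧⁻ (fibre P j z) p
            R≡ = [ (λ l → contradiction l notLeft) ,
                (λ h → h z (trans (⌊⌋-elim (P z ≟ᶠ j) Pz) (sym (⌊⌋-elim (P z₀ ≟ᶠ j) Pz₀)))) ]′
                    (aligned z₀)
        in Pz , m≤n⇒m≤n+o _ (≤-reflexive (sym (𝟙-true (deviates z)
            (subst (λ i → T (side g (not (maj i)) z)) (sym R≡) q)))))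

-- Equipartitions aligned with a labelling

count-unique : (Z : Fin n → Bool) → (∀ i j → T (Z i) → T (Z j) → i ≡ j) → count Z ≤ 1
count-unique {n} Z unique with any? (λ i → T? (Z i))
... | no none = ≤-trans (≤-reflexive (count-def Z))
    (≤-trans (∑-bounded {c = 0} λ i → ≤-reflexive (𝟙-false (Z i) λ p → none (i , p)))
                  (≤-trans (≤-reflexive (*-zeroʳ n)) z≤n))
... | yes (i , p) = ≤-trans (≤-reflexive (trans (count-def Z)
        (∑-single i (𝟙 ∘ Z) λ j j≢i → 𝟙-false (Z j) λ q → j≢i (unique j i q p)))) (𝟙≤1 (Z i))

∫-one : (Z : Fin n → Bool) → ∫ Z (λ _ → 1) ≡ count Z
∫-one Z = trans (∫-const Z 1) (*-identityʳ _)

∑-fibre-counts : (P : Fin n → Fin t) → ∑ (λ i → count (fibre P i)) ≡ n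
∑-fibre-counts {n} P = trans (∑-cong λ i → sym (∫-one (fibre P i)))
  (trans (sym (∑-fibres P λ _ → 1)) (trans (∑-const n 1) (*-identityʳ n)))

module _ (π : Fin n → Fin n) (injective : ∀ {i j} → π i ≡ π j → i ≡ j) where

  -- Pigeonhole: the n fibres have at most one element each and n elements together.
  count-fibre-injective : ∀ p → count (fibre π p) ≡ 1
  count-fibre-injective p = ≤-antisym (≤1 p) (≰⇒> λ ≤0 → <-irrefl refl (begin-strict
    n                                ≡⟨ ∑-fibre-counts π ⟨
    ∑ (λ i → count (fibre π i))      <⟨ ≤-reflexive (+-comm 1 _) ⟩
    ∑ (λ i → count (fibre π i)) + 1  ≤⟨ ∑-mono-gap ≤1 p (+-monoˡ-≤ 1 ≤0) ⟩
    ∑ {n} (λ _ → 1)                  ≡⟨ trans (∑-const n 1) (*-identityʳ n) ⟩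
    n                                ∎))
    where
    open ≤-Reasoning
    ≤1 : ∀ p → count (fibre π p) ≤ 1
    ≤1 p = count-unique (fibre π p) λ i j a b →
      injective (trans (⌊⌋-elim (π i ≟ᶠ p) a) (sym (⌊⌋-elim (π j ≟ᶠ p) b)))

  ∑-injective : (f : Fin n → ℕ) → ∑ (f ∘ π) ≡ ∑ f
  ∑-injective f = trans (∑-fibres π (f ∘ π)) (∑-cong λ p → trans (≤-antisym
      (∫-mono λ z e → ≤-reflexive (cong f (⌊⌋-elim (π z ≟ᶠ p) e)))
      (∫-mono λ z e → ≤-reflexive (cong f (sym (⌊⌋-elim (π z ≟ᶠ p) e)))))
    (trans (∫-const (fibre π p) (f p)) (trans (cong (_* f p) (count-fibre-injective p))
        (*-identityˡ _))))

block : (a : Fin t → ℕ) → Fin (Sum.sum a) → Fin t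
block {suc t} a p with splitAt (a zero) p
... | inj₁ _ = zero
... | inj₂ q = suc (block (a ∘ suc) q)

block-mono : (a : Fin t → ℕ) → ∀ p q → p Fin.≤ q → block a p Fin.≤ block a q
block-mono {suc t} a p q p≤q with splitAt (a zero) p in eq | splitAt (a zero) q in eq′
... | inj₁ _  | _       = z≤n
... | inj₂ p′ | inj₂ q′ = s≤s (block-mono (a ∘ suc) p′ q′ (+-cancelˡ-≤ (a zero) _ _ (begin
  a zero + toℕ p′      ≡⟨ Finₚ.toℕ-↑ʳ (a zero) p′ ⟨
  toℕ (a zero Fin.↑ʳ p′) ≡⟨ cong toℕ (Finₚ.splitAt⁻¹-↑ʳ eq) ⟩
  toℕ p                ≤⟨ p≤q ⟩
  toℕ q                ≡⟨ cong toℕ (Finₚ.splitAt⁻¹-↑ʳ eq′) ⟨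
  toℕ (a zero Fin.↑ʳ q′) ≡⟨ Finₚ.toℕ-↑ʳ (a zero) q′ ⟩
  a zero + toℕ q′      ∎)))
  where open ≤-Reasoning
... | inj₂ p′ | inj₁ q′ = contradiction p≤q (<⇒≱ (begin-strict
  toℕ q                ≡⟨ cong toℕ (Finₚ.splitAt⁻¹-↑ˡ eq′) ⟨
  toℕ (q′ Fin.↑ˡ _)    ≡⟨ Finₚ.toℕ-↑ˡ q′ _ ⟩
  toℕ q′               <⟨ Finₚ.toℕ<n q′ ⟩
  a zero               ≤⟨ m≤m+n _ _ ⟩
  a zero + toℕ p′      ≡⟨ Finₚ.toℕ-↑ʳ (a zero) p′ ⟨
  toℕ (a zero Fin.↑ʳ p′) ≡⟨ cong toℕ (Finₚ.splitAt⁻¹-↑ʳ eq) ⟩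
  toℕ p                ∎))
  where open ≤-Reasoning

block-count : (a : Fin t → ℕ) → ∀ j → count (fibre (block a) j) ≡ a j
block-count {suc t} a j = trans (count-def _) (trans (∑-join (a zero) _)
  (trans (cong₂ _+_ (∑-cong first) (∑-cong second)) (go j)))
  where
  first : ∀ i → 𝟙 (fibre (block a) j (i Fin.↑ˡ _)) ≡ 𝟙 ⌊ zero ≟ᶠ j ⌋
  first i rewrite Finₚ.splitAt-↑ˡ (a zero) i (Sum.sum (a ∘ suc)) = refl
  second : ∀ i → 𝟙 (fibre (block a) j (a zero Fin.↑ʳ i)) ≡ 𝟙 ⌊ suc (block (a ∘ suc) i) ≟ᶠ j ⌋
  second i rewrite Finₚ.splitAt-↑ʳ (a zero) (Sum.sum (a ∘ suc)) i = refl
  go : ∀ j → ∑ {a zero} (λ _ → 𝟙 ⌊ zero ≟ᶠ j ⌋) + ∑ (λ i → 𝟙 ⌊ suc (block (a ∘ suc) i) ≟ᶠ j ⌋) ≡ a j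
  go zero = trans (cong₂ _+_ (trans (∑-const (a zero) 1) (*-identityʳ _))
    (trans (∑-const (Sum.sum (a ∘ suc)) 0) (*-zeroʳ (Sum.sum (a ∘ suc))))) (+-identityʳ _)
  go (suc j) = cong₂ _+_ (trans (∑-const (a zero) 0) (*-zeroʳ (a zero)))
    (trans (∑-cong λ i → ≤-antisym
        (𝟙-mono ⌊ suc (block (a ∘ suc) i) ≟ᶠ suc j ⌋ _ λ e → ⌊⌋-intro (_ ≟ᶠ j)
            (Finₚ.suc-injective (⌊⌋-elim (_ ≟ᶠ suc j) e)))
        (𝟙-mono ⌊ block (a ∘ suc) i ≟ᶠ j ⌋ _ λ e → ⌊⌋-intro (_ ≟ᶠ suc j)
            (cong suc (⌊⌋-elim (_ ≟ᶠ j) e))))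
      (trans (sym (count-def _)) (block-count (a ∘ suc) j)))

module Position (key : Fin n → ℕ) (key-injective : ∀ {i j} → key i ≡ key j → i ≡ j) where

  below : Fin n → Fin n → Bool
  below z z′ = ⌊ key z′ <? key z ⌋

  count-below-mono : ∀ {z₁ z₂} → key z₁ < key z₂ → count (below z₁) < count (below z₂)
  count-below-mono {z₁} {z₂} lt = begin
    suc (count (below z₁))        ≡⟨ trans (+-comm 1 _) (cong (_+ 1) (count-def _)) ⟩
    ∑ (𝟙 ∘ below z₁) + 1          ≤⟨ ∑-mono-gap
      (λ z → 𝟙-mono (below z₁ z) _ λ p → ⌊⌋-intro (_ <? key z₂)
          (<-trans (⌊⌋-elim (_ <? key z₁) p) lt)) z₁
      (≤-reflexive (trans (cong (_+ 1) (𝟙-false (below z₁ z₁) λ p → <-irrefl refl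
          (⌊⌋-elim (_ <? key z₁) p)))
        (sym (𝟙-true _ (⌊⌋-intro (_ <? key z₂) lt))))) ⟩
    ∑ (𝟙 ∘ below z₂)              ≡⟨ count-def _ ⟨
    count (below z₂)              ∎
    where open ≤-Reasoning

  count-below<n : ∀ z → count (below z) < n
  count-below<n z = begin
    suc (count (below z))         ≡⟨ trans (+-comm 1 _) (cong (_+ 1) (count-def _)) ⟩
    ∑ (𝟙 ∘ below z) + 1           ≤⟨ ∑-mono-gap (𝟙≤1 ∘ below z) z
      (≤-reflexive (cong (_+ 1) (𝟙-false (below z z) λ p → <-irrefl refl
          (⌊⌋-elim (_ <? key z) p)))) ⟩
    ∑ {n} (λ _ → 1)               ≡⟨ trans (∑-const n 1) (*-identityʳ n) ⟩
    n                             ∎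
    where open ≤-Reasoning

  position : Fin n → Fin n
  position z = fromℕ< (count-below<n z)

  position-mono : ∀ {z₁ z₂} → key z₁ < key z₂ → position z₁ Fin.< position z₂
  position-mono {z₁} {z₂} lt = ≤-trans (s≤s (≤-reflexive (Finₚ.toℕ-fromℕ< (count-below<n z₁))))
    (≤-trans (count-below-mono lt) (≤-reflexive (sym (Finₚ.toℕ-fromℕ< (count-below<n z₂)))))

  position-injective : ∀ {i j} → position i ≡ position j → i ≡ j
  position-injective {i} {j} e with <-cmp (key i) (key j)
  ... | tri< lt _ _ = contradiction e (Finₚ.<⇒≢ (position-mono lt))
  ... | tri≈ _ eq _ = key-injective eq
  ... | tri> _ _ gt = contradiction (sym e) (Finₚ.<⇒≢ (position-mono gt))

-- The vertices are sorted by label, with ties broken by index to make the keys distinct, and cut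
-- into consecutive blocks of sizes a.
arrange : (a : Fin t → ℕ) → Sum.sum a ≡ n → (R : Fin n → Fin t′) →
  Σ[ P ∈ (Fin n → Fin t) ] (∀ j → count (fibre P j) ≡ a j) ×
      (∀ {z z′} → R z Fin.< R z′ → P z Fin.≤ P z′)
arrange {t = t} {t′ = t′} a refl R = P ,
  (λ j → trans (trans (count-def _) (trans (∑-injective position position-injective
      (𝟙 ∘ fibre (block a) j)) (sym (count-def _)))) (block-count a j)) ,
  λ {z} {z′} lt → block-mono a (position z) (position z′)
      (<⇒≤ (position-mono (Finₚ.combine-monoˡ-< z z′ lt)))
  where
  open Position (λ z → toℕ (combine (R z) z)) (λ {i} {j} e → Finₚ.combine-injectiveʳ (R i) i (R j) j (Finₚ.toℕ-injective e))
  P : Fin (Sum.sum a) → Fin t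
  P z = block a (position z)

sizes : ∀ t r s → r ≤ t → Σ[ a ∈ (Fin t → ℕ) ] Sum.sum a ≡ r + s * t × (∀ j → s ≤ a j × a j ≤ suc s)
sizes zero    zero    s le = (λ ()) , sym (*-zeroʳ s) , λ ()
sizes (suc t) zero    s le with sizes t zero s z≤n
... | a , eq , h = (λ { zero → s ; (suc j) → a j }) , trans (cong (s +_) eq) (sym (*-suc s t)) ,
      λ { zero → ≤-refl , n≤1+n s ; (suc j) → h j }
sizes (suc t) (suc r) s (s≤s le) with sizes t r s le
... | a , eq , h = (λ { zero → suc s ; (suc j) → a j }) , trans (cong (suc s +_) eq) (lemma r s t) ,
      λ { zero → n≤1+n s , ≤-refl ; (suc j) → h j }
      where
      lemma : ∀ r s t → suc s + (r + s * t) ≡ suc r + s * suc t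
      lemma = solve-∀

Aligned : (P : Fin n → Fin t) (R : Fin n → Fin t′) (left : Fin n → Bool) → Set
Aligned P R left = ∀ z → T (left z) ⊎ (∀ z′ → P z′ ≡ P z → R z′ ≡ R z)

Balanced : ℕ → (Fin n → Fin t) → Set
Balanced s P = ∀ j → s ≤ count (fibre P j) × count (fibre P j) ≤ suc s

-- The parts are consecutive in the order of labels, so for each label c at most one part contains
-- both c and a larger label. Hence at most t′ parts meet several labels, and `left` is the union of
-- these parts.
align : ∀ t .{{_ : NonZero t}} (R : Fin n → Fin t′) → Σ[ P ∈ (Fin n → Fin t) ] Balanced (n / t) P ×
  Σ[ left ∈ (Fin n → Bool) ] Aligned P R left × count left ≤ t′ * suc (n / t)
align {n} {t′} t R with sizes t (n % t) (n / t) (<⇒≤ (m%n<n n t))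
... | a , eq , bounds with arrange a (trans eq (sym (m≡m%n+[m/n]*n n t))) R
... | P , cnt , mono = P , balanced-P , left , aligned , count-left
  where
  s = n / t
  balanced-P : Balanced s P
  balanced-P j rewrite cnt j = bounds j
  left? : ∀ z → Dec (∃[ z′ ] P z′ ≡ P z × R z′ ≢ R z)
  left? z = any? λ z′ → (P z′ ≟ᶠ P z) ×-dec ¬? (R z′ ≟ᶠ R z)
  left : Fin n → Bool
  left z = ⌊ left? z ⌋
  aligned : Aligned P R left
  aligned z with left? z
  ... | yes _ = inj₁ tt
  ... | no  h = inj₂ λ z′ e → Dec.decidable-stable (R z′ ≟ᶠ R z) λ ne → h (z′ , e , ne)
  straddles? : ∀ c j → Dec (∃[ z ] ∃[ z′ ] (P z ≡ j × P z′ ≡ j) × (R z ≡ c × c Fin.< R z′))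
  straddles? c j = any? λ z → any? λ z′ → (P z ≟ᶠ j ×-dec P z′ ≟ᶠ j) ×-dec
      (R z ≟ᶠ c ×-dec c Finₚ.<? R z′)
  straddles : Fin t′ → Fin t → Bool
  straddles c j = ⌊ straddles? c j ⌋
  straddles-≤ : ∀ c i j → T (straddles c i) → T (straddles c j) → i Fin.≤ j
  straddles-≤ c i j p q with ⌊⌋-elim (straddles? c i) p | ⌊⌋-elim (straddles? c j) q
  ... | z , _ , (refl , _) , (refl , _) | _ , v , (_ , refl) , (_ , lt) = mono lt
  left⇒straddles : ∀ z → T (left z) → ∃[ c ] T (straddles c (P z))
  left⇒straddles z l with ⌊⌋-elim (left? z) l
  ... | z′ , e , ne with Finₚ.<-cmp (R z) (R z′)
  ...   | tri< lt _ _ = R z , ⌊⌋-intro (straddles? (R z) (P z)) (z , z′ , (refl , e) , (refl , lt))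
  ...   | tri≈ _ eq _ = contradiction (sym eq) ne
  ...   | tri> _ _ gt = R z′ , ⌊⌋-intro (straddles? (R z′) (P z))
      (z′ , z , (e , refl) , (refl , gt))
  open ≤-Reasoning
  perPart : ∀ j → ∫ (fibre P j) (𝟙 ∘ left) ≤ ∑ (λ c → 𝟙 (straddles c j)) * suc s
  perPart j = begin
    ∫ (fibre P j) (𝟙 ∘ left)                              ≤⟨ ∫-mono pointwise ⟩
    ∫ (fibre P j) (λ _ → ∑ (λ c → 𝟙 (straddles c j)))     ≡⟨ ∫-const (fibre P j) _ ⟩
    count (fibre P j) * ∑ (λ c → 𝟙 (straddles c j))       ≤⟨ *-monoˡ-≤ _ (proj₂ (balanced-P j)) ⟩
    suc s * ∑ (λ c → 𝟙 (straddles c j))                   ≡⟨ *-comm (suc s) _ ⟩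
    ∑ (λ c → 𝟙 (straddles c j)) * suc s                   ∎
    where
    pointwise : ∀ z → T (fibre P j z) → 𝟙 (left z) ≤ ∑ (λ c → 𝟙 (straddles c j))
    pointwise z Pz with T? (left z)
    ... | no nl = ≤-trans (≤-reflexive (𝟙-false (left z) nl)) z≤n
    ... | yes l with left⇒straddles z l
    ...   | c , st = ≤-trans (≤-trans (𝟙≤1 (left z)) (≤-reflexive (sym (𝟙-true (straddles c j)
              (subst (T ∘ straddles c) (⌊⌋-elim (P z ≟ᶠ j) Pz) st)))))
                  (≤-∑ (λ c → 𝟙 (straddles c j)) c)
  count-left : count left ≤ t′ * suc s
  count-left = begin
    count left                                     ≡⟨ count-def left ⟩
    ∑ (𝟙 ∘ left)                                   ≡⟨ ∑-fibres P (𝟙 ∘ left) ⟩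
    ∑ (λ j → ∫ (fibre P j) (𝟙 ∘ left))             ≤⟨ ∑-mono perPart ⟩
    ∑ (λ j → ∑ (λ c → 𝟙 (straddles c j)) * suc s)  ≡⟨ ∑-cong (λ j → *-comm _ (suc s)) ⟩
    ∑ (λ j → suc s * ∑ (λ c → 𝟙 (straddles c j)))  ≡⟨ ∑-*ˡ (suc s) _ ⟩
    suc s * ∑ (λ j → ∑ (λ c → 𝟙 (straddles c j)))  ≡⟨ cong (suc s *_) (∑-comm _) ⟩
    suc s * ∑ (λ c → ∑ (λ j → 𝟙 (straddles c j)))  ≤⟨ *-monoʳ-≤ (suc s) (∑-bounded λ c →
      ≤-trans (≤-reflexive (sym (count-def (straddles c)))) (count-unique (straddles c) λ i j p q →
        Finₚ.≤-antisym (straddles-≤ c i j p q) (straddles-≤ c j i q p))) ⟩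
    suc s * (t′ * 1)                               ≡⟨ trans (cong (suc s *_) (*-identityʳ t′))
        (*-comm (suc s) t′) ⟩
    t′ * suc s                                     ∎

-- Refining partitions of slicewise stable 3-graphs

module Slices (E : Fin n → Fin n → Fin n → Bool) (E-sym : ∀ x y z → E x y z ≡ E y x z)
  (K : ℕ) (noTree : ∀ x → ¬ Tree (E x) full K full) where

  module _ (P : Fin n → Fin t) (B : Fin m → Fin n) (x : Fin n) where

    typeCell? : ∀ z z′ → Dec (P z′ ≡ P z × (∀ l → E (B l) x z′ ≡ E (B l) x z))
    typeCell? z z′ = (P z′ ≟ᶠ P z) ×-dec all? λ l → E (B l) x z′ ≟ᵇ E (B l) x z

    typeCell : Fin n → Fin n → Bool
    typeCell z z′ = ⌊ typeCell? z z′ ⌋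

    rankTotal : ℕ
    rankTotal = Drop.rankSum (E x) K (noTree x) typeCell

    massTotal : ℕ
    massTotal = ∑ λ l → mass P (E (B l) x)

    -- The vertices of part j that agree with the majority for every b ∈ B form a single cell, if
    -- any exist. It stands in for the part; by a union bound over B the vertices outside it number
    -- at most the sum of the minorities.
    module MainNode (j : Fin t) where

      maj : Fin m → Bool
      maj l = majority (fibre P j) (E (B l) x)

      node? : ∀ z → Dec (P z ≡ j × (∀ l → E (B l) x z ≡ maj l))
      node? z = (P z ≟ᶠ j) ×-dec all? λ l → E (B l) x z ≟ᵇ maj l

      node exceptional : Fin n → Bool
      node z        = ⌊ node? z ⌋
      exceptional z = fibre P j z ∧ not (node z)

      node⊑ : node ⊑ fibre P j
      node⊑ z p = ⌊⌋-intro (P z ≟ᶠ j) (proj₁ (⌊⌋-elim (node? z) p))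

      count-exceptional : count exceptional ≤ ∑ λ l → minority (fibre P j) (E (B l) x)
      count-exceptional = begin
        count exceptional                                            ≡⟨ count-def _ ⟩
        ∑ (𝟙 ∘ exceptional)                                          ≤⟨ ∑-mono pointwise ⟩
        ∑ (λ z → ∑ λ l → 𝟙 (deviates l z))                           ≡⟨ ∑-comm
            (λ z l → 𝟙 (deviates l z)) ⟩
        ∑ (λ l → ∑ λ z → 𝟙 (deviates l z))                           ≡⟨ ∑-cong
            (λ l → sym (count-def (deviates l))) ⟩
        ∑ (λ l → count (deviates l))                                 ≡⟨ ∑-cong
            (λ l → count-minority (fibre P j) (E (B l) x)) ⟩
        ∑ (λ l → minority (fibre P j) (E (B l) x))                   ∎
        where
        open ≤-Reasoning
        deviates : Fin m → Fin n → Bool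
        deviates l = fibre P j ⊓ˢ side (E (B l) x) (not (maj l))
        ≢⇒≡not : ∀ a b → a ≢ b → a ≡ not b
        ≢⇒≡not true  true  ne = contradiction refl ne
        ≢⇒≡not true  false ne = refl
        ≢⇒≡not false true  ne = refl
        ≢⇒≡not false false ne = contradiction refl ne
        pointwise : ∀ z → 𝟙 (exceptional z) ≤ ∑ λ l → 𝟙 (deviates l z)
        pointwise z with T? (exceptional z)
        ... | no ne = ≤-trans (≤-reflexive (𝟙-false (exceptional z) ne)) z≤n
        ... | yes p with T-∧⁻ (fibre P j z) p
        ...   | Pz , notNode with Finₚ.¬∀⟶∃¬ m _ (λ l → E (B l) x z ≟ᵇ maj l)
                  (λ h → T-not notNode (⌊⌋-intro (node? z) (⌊⌋-elim (P z ≟ᶠ j) Pz , h)))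
          where
          T-not : ∀ {b} → T (not b) → ¬ T b
          T-not {true} ()
          T-not {false} _ ()
        ...     | l , ne = ≤-trans (≤-trans (𝟙≤1 (exceptional z))
            (≤-reflexive (sym (𝟙-true (deviates l z)
                    (T-∧⁺ Pz (⌊⌋-intro (_ ≟ᵇ _) (≢⇒≡not _ _ ne)))))))
                        (≤-∑ (λ l → 𝟙 (deviates l z)) l)

      count≤node : ∀ g s → count (fibre P j ⊓ˢ side g s) ≤ count
          (node ⊓ˢ side g s) + count exceptional
      count≤node g s = begin
        count (fibre P j ⊓ˢ side g s)                           ≡⟨ count-def _ ⟩
        ∑ (𝟙 ∘ (fibre P j ⊓ˢ side g s))                         ≤⟨ ∑-mono
            (λ z → pointwise (fibre P j z) (node z) (side g s z)) ⟩
        ∑ (λ z → 𝟙 ((node ⊓ˢ side g s) z) + 𝟙 (exceptional z))  ≡⟨ ∑-+ _ _ ⟩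
        ∑ (𝟙 ∘ (node ⊓ˢ side g s)) + ∑ (𝟙 ∘ exceptional)        ≡⟨ cong₂ _+_ (count-def _)
            (count-def _) ⟨
        count (node ⊓ˢ side g s) + count exceptional            ∎
        where
        open ≤-Reasoning
        pointwise : ∀ a b c → 𝟙 (a ∧ c) ≤ 𝟙 (b ∧ c) + 𝟙 (a ∧ not b)
        pointwise false b     c = z≤n
        pointwise true  true  c = m≤m+n _ _
        pointwise true  false c = 𝟙≤1 c

      minority≤node : ∀ g → minority (fibre P j) g ≤ minority node g + count exceptional
      minority≤node g = ≤-trans (⊓-mono-≤ (count≤node g true) (count≤node g false))
        (≤-reflexive (sym (+-distribʳ-⊓ (count exceptional) _ _)))

  -- Ψ is the potential; M bounds the failure of the parts of P to be cells.
  Ψ M : (Fin n → Fin t) → (Fin m → Fin n) → ℕ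
  Ψ P B = ∑ λ x → rankTotal P B x
  M P B = ∑ λ x → massTotal P B x

  splitting : (Fin n → Fin t) → Fin t → Fin t → Fin n → ℕ
  splitting P i j y = ∫ (fibre P i) λ x → minority (fibre P j) (E x y)

  module _ (P : Fin n → Fin t) (B : Fin m → Fin n) (B′ : Fin m′ → Fin n)
    (B⊆B′ : ∀ l → ∃[ l′ ] B′ l′ ≡ B l) where

    typeCell-⊑ : ∀ x z → typeCell P B′ x z ⊑ typeCell P B x z
    typeCell-⊑ x z z′ p with ⌊⌋-elim (typeCell? P B′ x z z′) p
    ... | P≡ , h = ⌊⌋-intro (typeCell? P B x z z′) (P≡ , λ l → let l′ , eq = B⊆B′ l in
      subst (λ b → E b x z′ ≡ E b x z) eq (h l′))

    module _ (y : Fin t → Fin t → Fin n) (y∈B′ : ∀ i j → ∃[ l ] B′ l ≡ y i j) where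

      -- For x in part i only the witnesses `y i j` are used. They lower ranks of vertices z in
      -- distinct parts j, so the drops add up within one slice; replacing each part by its main
      -- cell costs `massTotal`.
      slice-drop : ∀ x → ∑ (λ j → minority (fibre P j) (E x (y (P x) j))) + rankTotal P B′ x ≤
        rankTotal P B x + massTotal P B x
      slice-drop x = begin
        ∑ (λ j → minority (fibre P j) (E x (y (P x) j))) + rankTotal P B′ x       ≤⟨ +-monoˡ-≤ _
            (∑-mono perPart) ⟩
        ∑ (λ j → ∫ (fibre P j) drop + ∑ λ l → minority (fibre P j) (E (B l) x)) + rankTotal P B′ x
          ≡⟨ cong (_+ rankTotal P B′ x) (trans (∑-+ _ _)
              (cong₂ _+_ (sym (∑-fibres P drop)) (∑-comm _))) ⟩
        ∑ drop + massTotal P B x + rankTotal P B′ x                               ≡⟨ lemma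
            (∑ drop) _ _ ⟩
        rankTotal P B′ x + ∑ drop + massTotal P B x                               ≤⟨ +-monoˡ-≤ _
            (rankSum-dropped _ _ (typeCell-⊑ x)) ⟩
        rankTotal P B x + massTotal P B x                                         ∎
        where
        open ≤-Reasoning
        open Drop (E x) K (noTree x)
        drop : Fin n → ℕ
        drop = 𝟙 ∘ dropped (typeCell P B x) (typeCell P B′ x)
        lemma : ∀ a b c → a + b + c ≡ c + a + b
        lemma = solve-∀
        perPart : ∀ j → minority (fibre P j) (E x (y (P x) j)) ≤
          ∫ (fibre P j) drop + ∑ λ l → minority (fibre P j) (E (B l) x)
        perPart j = ≤-trans (minority≤node (E x (y (P x) j))) (+-mono-≤
          (≤-trans (minority≤dropped (typeCell P B x) (typeCell P B′ x) node
              (y (P x) j) node⊑old new⊑)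
            (≤-trans (≤-reflexive (∫-def node _)) (≤-trans
              (∑-mono λ z → *-monoˡ-≤ (drop z) (𝟙-mono (node z) _ (node⊑ z)))
              (≤-reflexive (sym (∫-def (fibre P j) _))))))
          count-exceptional)
          where
          open MainNode P B x j
          node⊑old : ∀ z → T (node z) → node ⊑ typeCell P B x z
          node⊑old z Nz z′ Nz′ with ⌊⌋-elim (node? z) Nz | ⌊⌋-elim (node? z′) Nz′
          ... | P≡ , h | P≡′ , h′ = ⌊⌋-intro (typeCell? P B x z z′)
            (trans P≡′ (sym P≡) , λ l → trans (h′ l) (sym (h l)))
          new⊑ : ∀ z → T (node z) → typeCell P B′ x z ⊑ node ⊓ˢ side (E x (y (P x) j))
              (E x (y (P x) j) z)
          new⊑ z Nz z′ p with ⌊⌋-elim (node? z) Nz | ⌊⌋-elim (typeCell? P B x z z′)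
              (typeCell-⊑ x z z′ p)
                            | ⌊⌋-elim (typeCell? P B′ x z z′) p | y∈B′ (P x) j
          ... | P≡ , h | P≡′ , h′ | _ , h″ | l , eq = T-∧⁺
            (⌊⌋-intro (node? z′) (trans P≡′ P≡ , λ l → trans (h′ l) (h l)))
            -- The cells were cut by E y x; symmetry turns this into the split of the slice E x by
            -- the node y.
            (⌊⌋-intro (_ ≟ᵇ _) (trans (E-sym x _ z′) (trans
              (subst (λ b → E b x z′ ≡ E b x z) eq (h″ l)) (E-sym _ x z))))

      Ψ-drop : ∑ (λ i → ∑ λ j → splitting P i j (y i j)) + Ψ P B′ ≤ Ψ P B + M P B
      Ψ-drop = begin
        ∑ (λ i → ∑ λ j → splitting P i j (y i j)) + Ψ P B′
          ≡⟨ cong (_+ Ψ P B′) (∑-cong perPart) ⟩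
        ∑ (λ i → ∫ (fibre P i) f) + Ψ P B′                    ≡⟨ cong (_+ Ψ P B′) (∑-fibres P f) ⟨
        ∑ f + Ψ P B′                                          ≡⟨ ∑-+ f _ ⟨
        ∑ (λ x → f x + rankTotal P B′ x)                      ≤⟨ ∑-mono slice-drop ⟩
        ∑ (λ x → rankTotal P B x + massTotal P B x)           ≡⟨ ∑-+ _ _ ⟩
        Ψ P B + M P B                                         ∎
        where
        open ≤-Reasoning
        f : Fin n → ℕ
        f x = ∑ λ j → minority (fibre P j) (E x (y (P x) j))
        perPart : ∀ i → ∑ (λ j → splitting P i j (y i j)) ≡ ∫ (fibre P i) f
        perPart i = trans (sym (∫-∑ (fibre P i) λ x j → minority (fibre P j) (E x (y i j))))
            (≤-antisym
          (∫-mono λ x p → ≤-reflexive (∑-cong λ j → cong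
              (λ i → minority (fibre P j) (E x (y i j))) (sym (⌊⌋-elim (P x ≟ᶠ i) p))))
          (∫-mono λ x p → ≤-reflexive (∑-cong λ j → cong
              (λ i → minority (fibre P j) (E x (y i j))) (⌊⌋-elim (P x ≟ᶠ i) p))))

-- The iteration

module Parameters (K e t₀ : ℕ) .{{_ : NonZero e}} where

  opaque
    -- Each pair of splitting at least size² / threshold is bad, and each round
    -- lowers Ψ by at least n² / (2 * gain) if all errors are at most
    -- n² / (4 * gain), which the precision ensures.
    threshold gain : ℕ
    threshold = 12 * e
    gain      = 4 * e * threshold

    precision : ℕ → ℕ
    precision m = 8 * gain * suc (m + K)

    -- The outcome of `regularise` for m graphs, whose potential is at most m K n, starting from t
    -- labels.
    labels : ℕ → ℕ → ℕ
    labels t m = 2 ^ (precision m * (m * K)) * t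

    -- With this many parts, the straddling ones, at most one for each label, contain at most n /
    -- `precision m` vertices in total; the factor 2 absorbs the possible extra vertex of a part.
    -- The summand `suc t₀` provides t₀ parts and a nonzero divisor.
    nextSize : ℕ → ℕ → ℕ
    nextSize t m = suc t₀ + precision m * (labels t m * 2)

    threshold-def : threshold ≡ 12 * e
    threshold-def = refl

    gain-def : gain ≡ 4 * e * threshold
    gain-def = refl

    precision-def : ∀ m → precision m ≡ 8 * gain * suc (m + K)
    precision-def m = refl

    labels-def : ∀ t m → labels t m ≡ 2 ^ (precision m * (m * K)) * t
    labels-def t m = refl

    t₀≤nextSize : ∀ t m → t₀ ≤ nextSize t m
    t₀≤nextSize t m = ≤-trans (n≤1+n t₀) (m≤m+n (suc t₀) _)

    labels≤nextSize : ∀ t m → precision m * (labels t m * 2) ≤ nextSize t m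
    labels≤nextSize t m = m≤n+m _ (suc t₀)

    instance
      nextSize-nonZero : ∀ {t m} → NonZero (nextSize t m)
      nextSize-nonZero = _

  -- Here f counts the remaining rounds, t the parts and m the size of B, which gains one vertex for
  -- each ordered pair of parts. The sizes are added up so that the bound covers every round in
  -- which the search may stop.
  sizeBound : ℕ → ℕ → ℕ → ℕ
  sizeBound zero    t m = t
  sizeBound (suc f) t m = t + sizeBound f (nextSize t (m + t * t)) (m + t * t)

  sizeBound≥ : ∀ f t m → t ≤ sizeBound f t m
  sizeBound≥ zero    t m = ≤-refl
  sizeBound≥ (suc f) t m = m≤m+n t _

  -- Initially `4 * gain * Ψ` is at most 4 `gain` K n², and each round takes away 2 n²; hence 2
  -- `gain` K rounds.
  totalBound : ℕ
  totalBound = sizeBound (2 * gain * K) (nextSize 1 0) 0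

  module Iteration {n} (n>0 : 0 < n) (E : Fin n → Fin n → Fin n → Bool)
    (E-sym : ∀ x y z → E x y z ≡ E y x z) (noTree : ∀ x → ¬ Tree (E x) full K full) where

    open Slices E E-sym K noTree

    -- Squaring `n≤` produces the factor 4 in `gain`.
    record Equitable (t : ℕ) (P : Fin n → Fin t) : Set where
      field
        size     : ℕ
        size-bal : Balanced size P
        n≤       : n ≤ 2 * (t * size)

    bad? : (P : Fin n → Fin t) (s : ℕ) → ∀ i j →
      Dec (∃[ y ] s * s ≤ threshold * splitting P i j y)
    bad? P s i j = any? λ y → s * s ≤? threshold * splitting P i j y

    badPairs : (P : Fin n → Fin t) → ℕ → ℕ
    badPairs P s = ∑ λ i → ∑ λ j → 𝟙 ⌊ bad? P s i j ⌋

    -- Outside `left` the new cell of z lies in its old cell. On `left` nothing is known except that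
    -- ranks are at most K, in each of the n slices.
    Ψ-aligned : (P′ : Fin n → Fin t′) (R : Fin n → Fin m′) (P : Fin n → Fin t)
        (left : Fin n → Bool) →
      Aligned P′ R left → Refines R P → (B : Fin m → Fin n) →
      Ψ P′ B ≤ Ψ P B + n * (K * count left)
    Ψ-aligned P′ R P left aligned ref B = begin
      Ψ P′ B                                              ≤⟨ ∑-mono perSlice ⟩
      ∑ (λ x → rankTotal P B x + K * count left)          ≡⟨ ∑-+ _ _ ⟩
      Ψ P B + ∑ {n} (λ _ → K * count left)                ≡⟨ cong (Ψ P B +_) (∑-const n _) ⟩
      Ψ P B + n * (K * count left)                        ∎
      where
      open ≤-Reasoning
      perSlice : ∀ x → rankTotal P′ B x ≤ rankTotal P B x + K * count left
      perSlice x = ≤-trans (∑-mono perVertex) (≤-reflexive (trans (∑-+ _ _)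
        (cong (rankTotal P B x +_) (trans (∑-*ˡ K (𝟙 ∘ left))
            (cong (K *_) (sym (count-def left)))))))
        where
        open Rank (E x)
        perVertex : ∀ z → rank K (typeCell P′ B x z) ≤ rank K (typeCell P B x z) + K * 𝟙 (left z)
        perVertex z with aligned z
        ... | inj₁ l = ≤-trans (rank≤ K _) (≤-trans
            (≤-reflexive (sym (trans (cong (K *_) (𝟙-true (left z) l)) (*-identityʳ K))))
                (m≤n+m _ _))
        ... | inj₂ h = ≤-trans (rank-mono K λ z′ p → let P≡ , q = ⌊⌋-elim (typeCell? P′ B x z z′) p in
          ⌊⌋-intro (typeCell? P B x z z′) (ref z′ z (h z′ P≡) , q)) (m≤m+n _ _)

    Ψ≤ : (P : Fin n → Fin t) (B : Fin m → Fin n) → Ψ P B ≤ K * (n * n)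
    Ψ≤ P B = ≤-trans (∑-bounded λ x → ∑-bounded λ z → Rank.rank≤ (E x) K _)
        (≤-reflexive (lemma n K))
      where
      lemma : ∀ n K → n * (n * K) ≡ K * (n * n)
      lemma = solve-∀

    opaque
      advance : (P : Fin n → Fin t) (B : Fin m → Fin n) → nextSize t m ≤ n →
        Σ[ P′ ∈ (Fin n → Fin (nextSize t m)) ] Equitable (nextSize t m) P′ ×
        4 * gain * M P′ B ≤ n * n × 4 * gain * Ψ P′ B ≤ 4 * gain * Ψ P B + n * n
      advance {t} {m} P B large with GraphRegularity.regularise (λ l → E (B l)) K
          (λ l → noTree (B l))
        h (h * (m * K)) P (≤-trans (*-monoʳ-≤ h (GraphRegularity.potential≤ (λ l → E (B l)) K
            (λ l → noTree (B l)) P))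
          (≤-reflexive (sym (*-assoc h (m * K) n))))
        where
        h : ℕ
        h = precision m
      ... | t′ , R , t′≤ , ref , reg with align (nextSize t m) R
      ... | P′ , bal , left , aligned , left≤ =
        P′ , record { size = s ; size-bal = bal ; n≤ = n≤′ } , M-small , Ψ-small
        where
        open ≤-Reasoning
        h τ s : ℕ
        h = precision m
        τ = nextSize t m
        s = n / τ
        s≥1 : 1 ≤ s
        s≥1 = ≰⇒> λ s≤0 → <⇒≱ (m%n<n n τ) (begin
          τ              ≤⟨ large ⟩
          n              ≡⟨ m≡m%n+[m/n]*n n τ ⟩
          n % τ + s * τ  ≡⟨ cong (λ a → n % τ + a * τ) (n≤0⇒n≡0 s≤0) ⟩
          n % τ + 0      ≡⟨ +-identityʳ _ ⟩
          n % τ          ∎)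
        n≤′ : n ≤ 2 * (τ * s)
        n≤′ = begin
          n              ≡⟨ m≡m%n+[m/n]*n n τ ⟩
          n % τ + s * τ  ≤⟨ +-monoˡ-≤ _ (≤-trans (<⇒≤ (m%n<n n τ))
              (≤-trans (≤-reflexive (sym (*-identityˡ τ))) (*-monoˡ-≤ τ s≥1))) ⟩
          s * τ + s * τ  ≡⟨ lemma s τ ⟩
          2 * (τ * s)    ∎
          where
          lemma : ∀ s τ → s * τ + s * τ ≡ 2 * (τ * s)
          lemma = solve-∀
        left-small : h * count left ≤ n
        left-small = begin
          h * count left                      ≤⟨ *-monoʳ-≤ h left≤ ⟩
          h * (t′ * suc s)                    ≤⟨ *-monoʳ-≤ h
              (*-mono-≤ (≤-trans t′≤ (≤-reflexive (sym (labels-def t m)))) (+-monoˡ-≤ s s≥1)) ⟩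
          h * (labels t m * (s + s))          ≡⟨ lemma h (labels t m) s ⟩
          s * (h * (labels t m * 2))          ≤⟨ *-monoʳ-≤ s (labels≤nextSize t m) ⟩
          s * τ                               ≤⟨ m/n*n≤m n τ ⟩
          n                                   ∎
          where
          lemma : ∀ h l s → h * (l * (s + s)) ≡ s * (h * (l * 2))
          lemma = solve-∀
        c : ℕ
        c = suc (m + K)
        M-small : 4 * gain * M P′ B ≤ n * n
        -- The precision is 2c times `4 * gain`: the factor 2 covers the two errors of
        -- `mass-aligned`, and c ≥ m covers the sum over the m graphs. That c ≥ K is used for
        -- `Ψ-small`.
        M-small = *-cancelˡ-≤ (2 * c) (begin
          2 * c * (4 * gain * M P′ B)                           ≡⟨ trans (regroup c gain (M P′ B))
              (cong (_* M P′ B) (sym (precision-def m))) ⟩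
          h * M P′ B                                            ≡⟨ ∑-*ˡ h _ ⟨
          ∑ (λ x → h * massTotal P′ B x)                        ≤⟨ ∑-bounded (λ x → ≤-trans
            (≤-reflexive (sym (∑-*ˡ h _))) (∑-bounded λ l → perMass l x)) ⟩
          n * (m * (n + n))                                     ≡⟨ regroup′ n m ⟩
          2 * m * (n * n)                                       ≤⟨ *-monoˡ-≤ (n * n)
              (*-monoʳ-≤ 2 (≤-trans (m≤m+n m K) (n≤1+n _))) ⟩
          2 * c * (n * n)                                       ∎)
          where
          regroup : ∀ c g a → 2 * c * (4 * g * a) ≡ 8 * g * c * a
          regroup = solve-∀
          regroup′ : ∀ n m → n * (m * (n + n)) ≡ 2 * m * (n * n)
          regroup′ = solve-∀
          perMass : ∀ l x → h * mass P′ (E (B l) x) ≤ n + n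
          perMass l x = begin
            h * mass P′ (E (B l) x)                    ≤⟨ *-monoʳ-≤ h
                (mass-aligned P′ R left aligned (E (B l) x)) ⟩
            h * (mass R (E (B l) x) + count left)      ≡⟨ *-distribˡ-+ h _ _ ⟩
            h * mass R (E (B l) x) + h * count left    ≤⟨ +-mono-≤ (reg l x) left-small ⟩
            n + n                                      ∎
        Ψ-small : 4 * gain * Ψ P′ B ≤ 4 * gain * Ψ P B + n * n
        Ψ-small = begin
          4 * gain * Ψ P′ B                                          ≤⟨ *-monoʳ-≤ (4 * gain)
              (Ψ-aligned P′ R P left aligned ref B) ⟩
          4 * gain * (Ψ P B + n * (K * count left))                  ≡⟨ regroup gain (Ψ P B) n K
              (count left) ⟩
          4 * gain * Ψ P B + n * (4 * gain * K * count left)         ≤⟨ +-monoʳ-≤ _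
              (*-monoʳ-≤ n (≤-trans
            (*-monoˡ-≤ (count left) (≤-trans (*-mono-≤ (*-monoˡ-≤ gain (m≤m+n 4 4))
                (≤-trans (m≤n+m K m) (n≤1+n _)))
              (≤-reflexive (sym (precision-def m))))) left-small)) ⟩
          4 * gain * Ψ P B + n * n                                   ∎
          where
          regroup : ∀ g a n K l → 4 * g * (a + n * (K * l)) ≡ 4 * g * a + n * (4 * g * K * l)
          regroup = solve-∀

    record GoodPartition (bound : ℕ) : Set where
      field
        parts     : ℕ
        t₀≤parts  : t₀ ≤ parts
        parts≤    : parts ≤ bound
        labelling : Fin n → Fin parts
        equitable : Equitable parts labelling
        few-bad   : e * badPairs labelling (Equitable.size equitable) ≤ parts * parts

    weaken : ∀ {b c} → b ≤ c → GoodPartition b → GoodPartition c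
    weaken b≤c G = record { GoodPartition G ; parts≤ = ≤-trans (GoodPartition.parts≤ G) b≤c }

    append : (Fin m → Fin n) → (Fin t → Fin t → Fin n) → Fin (m + t * t) → Fin n
    append {m} {t} B y l = [ B , (λ k → let i , j = remQuot t k in y i j) ]′ (splitAt m l)

    choose : ∀ {A : Fin n → Set} (A? : Dec (∃ A)) → Σ[ y ∈ Fin n ] (T ⌊ A? ⌋ → A y)
    choose (yes (y , p)) = y , λ _ → p
    -- A pair that is not bad receives an arbitrary vertex, since only bad pairs enter the lower
    -- bound for the total splitting.
    choose (no _)        = fromℕ< n>0 , λ ()

    𝟙*≤ : ∀ b {a c} → (T b → a ≤ c) → 𝟙 b * a ≤ c
    𝟙*≤ true  h = ≤-trans (≤-reflexive (*-identityˡ _)) (h tt)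
    𝟙*≤ false h = z≤n

    splitter : (P : Fin n → Fin t) → ℕ → Fin t → Fin t → Fin n
    splitter P s i j = proj₁ (choose (bad? P s i j))

    totalSplitting : (P : Fin n → Fin t) → ℕ → ℕ
    totalSplitting P s = ∑ λ i → ∑ λ j → splitting P i j (splitter P s i j)

    badPairs≤ : (P : Fin n → Fin t) (s : ℕ) → badPairs P s * (s * s) ≤
        threshold * totalSplitting P s
    badPairs≤ {t} P s = begin
      badPairs P s * (s * s)      ≡⟨ *-comm (badPairs P s) _ ⟩
      s * s * badPairs P s        ≡⟨ trans (sym (∑-*ˡ (s * s) _))
          (∑-cong λ i → trans (sym (∑-*ˡ (s * s) _)) (∑-cong λ j → *-comm (s * s) _)) ⟩
      ∑ (λ i → ∑ λ j → 𝟙 ⌊ bad? P s i j ⌋ * (s * s)) ≤⟨ ∑-mono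
          (λ i → ∑-mono λ j → 𝟙*≤ ⌊ bad? P s i j ⌋ (proj₂ (choose (bad? P s i j)))) ⟩
      ∑ (λ i → ∑ λ j → threshold * splitting P i j (splitter P s i j)) ≡⟨ trans
          (∑-cong λ i → ∑-*ˡ threshold _) (∑-*ˡ threshold _) ⟩
      threshold * totalSplitting P s         ∎
      where open ≤-Reasoning

    totalSplitting≥ : (P : Fin n → Fin t) (s : ℕ) → n ≤ 2 * (t * s) → t * t ≤ e * badPairs P s →
      n * n ≤ gain * totalSplitting P s
    totalSplitting≥ {t} P s n≤ many = begin
      n * n                                               ≤⟨ *-mono-≤ n≤ n≤ ⟩
      2 * (t * s) * (2 * (t * s))                         ≡⟨ regroup t s ⟩
      4 * (t * t * (s * s))                               ≤⟨ *-monoʳ-≤ 4 (*-monoˡ-≤ (s * s) many) ⟩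
      4 * (e * badPairs P s * (s * s))                    ≡⟨ regroup′ e (badPairs P s) (s * s) ⟩
      4 * e * (badPairs P s * (s * s))                    ≤⟨ *-monoʳ-≤ (4 * e) (badPairs≤ P s) ⟩
      4 * e * (threshold * totalSplitting P s)            ≡⟨ trans
          (cong (_* totalSplitting P s) gain-def) (*-assoc (4 * e) threshold _) ⟨
      gain * totalSplitting P s                           ∎
      where
      open ≤-Reasoning
      regroup : ∀ t s → 2 * (t * s) * (2 * (t * s)) ≡ 4 * (t * t * (s * s))
      regroup = solve-∀
      regroup′ : ∀ e b s → 4 * (e * b * s) ≡ 4 * e * (b * s)
      regroup′ = solve-∀

    opaque
      -- Scaled by `4 * gain`, the splitting by all witnesses is worth at least 4 n², of which the
      -- error `M` takes back at most n². The following `advance` spends another n², so a full round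
      -- nets 2 n².
      extend : (P : Fin n → Fin t) (B : Fin m → Fin n) (s : ℕ) → n ≤ 2 * (t * s) →
        t * t ≤ e * badPairs P s → 4 * gain * M P B ≤ n * n →
        Σ[ B′ ∈ (Fin (m + t * t) → Fin n) ] 3 * (n * n) + 4 * gain * Ψ P B′ ≤ 4 * gain * Ψ P B
      extend {t} {m} P B s n≤ many M-small = B′ , +-cancelʳ-≤ (n * n) _ _ (begin
        3 * (n * n) + 4 * gain * Ψ P B′ + n * n     ≡⟨ regroup (n * n) (4 * gain * Ψ P B′) ⟩
        4 * (n * n) + 4 * gain * Ψ P B′             ≤⟨ +-monoˡ-≤ _
            (*-monoʳ-≤ 4 (totalSplitting≥ P s n≤ many)) ⟩
        4 * (gain * totalSplitting P s) + 4 * gain * Ψ P B′ ≡⟨ regroup′ gain (totalSplitting P s)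
            (Ψ P B′) ⟩
        4 * gain * (totalSplitting P s + Ψ P B′)    ≤⟨ *-monoʳ-≤ (4 * gain)
            (Ψ-drop P B B′ B⊆B′ (splitter P s) y∈B′) ⟩
        4 * gain * (Ψ P B + M P B)                  ≡⟨ *-distribˡ-+ (4 * gain) _ _ ⟩
        4 * gain * Ψ P B + 4 * gain * M P B         ≤⟨ +-monoʳ-≤ _ M-small ⟩
        4 * gain * Ψ P B + n * n                    ∎)
        where
        open ≤-Reasoning
        B′ : Fin (m + t * t) → Fin n
        B′ = append B (splitter P s)
        B⊆B′ : ∀ l → ∃[ l′ ] B′ l′ ≡ B l
        B⊆B′ l = l Fin.↑ˡ (t * t) , cong [ B , _ ]′ (Finₚ.splitAt-↑ˡ m l (t * t))
        y∈B′ : ∀ i j → ∃[ l ] B′ l ≡ splitter P s i j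
        y∈B′ i j = m Fin.↑ʳ combine i j , trans (cong [ B , _ ]′
            (Finₚ.splitAt-↑ʳ m (t * t) (combine i j)))
          (cong (λ (i , j) → splitter P s i j) (Finₚ.remQuot-combine i j))
        regroup : ∀ a b → 3 * a + b + a ≡ 4 * a + b
        regroup = solve-∀
        regroup′ : ∀ g s a → 4 * (g * s) + 4 * g * a ≡ 4 * g * (s + a)
        regroup′ = solve-∀

    search : ∀ f (P : Fin n → Fin t) (B : Fin m → Fin n) → t₀ ≤ t → Equitable t P →
      4 * gain * M P B ≤ n * n → 4 * gain * Ψ P B ≤ 2 * f * (n * n) → sizeBound f t m ≤ n →
      GoodPartition (sizeBound f t m)
    searchMore : ∀ f (P : Fin n → Fin t) (B : Fin m → Fin n) (s : ℕ) → n ≤ 2 * (t * s) →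
      t * t ≤ e * badPairs P s →
      4 * gain * M P B ≤ n * n → 4 * gain * Ψ P B ≤ 2 * f * (n * n) → sizeBound f t m ≤ n →
      GoodPartition (sizeBound f t m)

    search {t} {m} f P B t₀≤t eq M-small Ψ-small large =
      [ (λ few → record { parts = t ; t₀≤parts = t₀≤t ; parts≤ = sizeBound≥ f t m ; labelling = P
          ; equitable = eq ; few-bad = few })
      , (λ many → searchMore f P B size n≤ many M-small Ψ-small large)
      ]′ (≤-total (e * badPairs P size) (t * t))
      where open Equitable eq

    -- No potential is left, yet one more extension would lower it by a positive amount.
    searchMore {t} {m} zero P B s n≤ many M-small Ψ-small large = contradiction (begin
      1                                     ≤⟨ *-mono-≤ n>0 n>0 ⟩
      n * n                                 ≤⟨ m≤m+n (n * n) _ ⟩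
      3 * (n * n)                           ≤⟨ m≤m+n (3 * (n * n)) _ ⟩
      3 * (n * n) + 4 * gain * Ψ P B′       ≤⟨ dropped ⟩
      4 * gain * Ψ P B                      ≤⟨ Ψ-small ⟩
      0                                     ∎) λ ()
      where
      open ≤-Reasoning
      extended = extend P B s n≤ many M-small
      B′ = proj₁ extended
      dropped = proj₂ extended
    searchMore {t} {m} (suc f) P B s n≤ many M-small Ψ-small large =
      weaken (m≤n+m _ t) (search f P′ B′ (t₀≤nextSize _ _) (proj₁ (proj₂ advanced))
          (proj₁ (proj₂ (proj₂ advanced)))
        (+-cancelˡ-≤ (2 * (n * n)) _ _ (begin
          2 * (n * n) + 4 * gain * Ψ P′ B′                ≤⟨ +-monoʳ-≤ _
              (proj₂ (proj₂ (proj₂ advanced))) ⟩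
          2 * (n * n) + (4 * gain * Ψ P B′ + n * n)       ≡⟨ regroup (n * n) (4 * gain * Ψ P B′) ⟩
          3 * (n * n) + 4 * gain * Ψ P B′                 ≤⟨ proj₂ extended ⟩
          4 * gain * Ψ P B                                ≤⟨ Ψ-small ⟩
          2 * suc f * (n * n)                             ≡⟨ regroup′ f (n * n) ⟩
          2 * (n * n) + 2 * f * (n * n)                   ∎))
        (≤-trans (m≤n+m _ t) large))
      where
      open ≤-Reasoning
      extended = extend P B s n≤ many M-small
      B′ = proj₁ extended
      advanced = advance P B′ (≤-trans (sizeBound≥ f _ _) (≤-trans (m≤n+m _ t) large))
      P′ = proj₁ advanced
      regroup : ∀ a b → 2 * a + (b + a) ≡ 3 * a + b
      regroup = solve-∀
      regroup′ : ∀ f a → 2 * suc f * a ≡ 2 * a + 2 * f * a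
      regroup′ = solve-∀

    goodPartition : totalBound ≤ n → GoodPartition totalBound
    -- With a single label and empty B, this call merely creates an equipartition into at least t₀
    -- parts.
    goodPartition large with advance {t = 1} (λ _ → zero) (λ ())
        (≤-trans (sizeBound≥ (2 * gain * K) _ 0) large)
    ... | P , eq , M-small , _ = search (2 * gain * K) P (λ ()) (t₀≤nextSize _ _) eq M-small
      (≤-trans (*-monoʳ-≤ (4 * gain) (Ψ≤ P _)) (≤-reflexive (regroup gain K (n * n)))) large
      where
      regroup : ∀ g K a → 4 * g * (K * a) ≡ 2 * (2 * g * K) * a
      regroup = solve-∀

-- Homogeneous triples

minority-cong : (Z : Fin n → Bool) {g h : Fin n → Bool} → (∀ z → g z ≡ h z) → minority Z g ≤
    minority Z h
minority-cong Z {g} {h} g≗h = ⊓-mono-≤ (count-mono (sub true)) (count-mono (sub false))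
  where
  sub : ∀ s → Z ⊓ˢ side g s ⊑ Z ⊓ˢ side h s
  sub s z = subst (λ b → T (Z z ∧ ⌊ b ≟ᵇ s ⌋)) (g≗h z)

∫-side : (Z g : Fin n → Bool) → ∫ Z (λ z → 𝟙 (g z)) ≡ count (Z ⊓ˢ side g true) ×
  ∫ Z (λ z → 𝟙 (not (g z))) ≡ count (Z ⊓ˢ side g false)
∫-side Z g =
  trans (∫-def Z _) (trans (∑-cong λ z → trans (sym (𝟙-∧ (Z z) _))
      (cong (λ b → 𝟙 (Z z ∧ b)) (is-true (g z)))) (sym (count-def _))) ,
  trans (∫-def Z _) (trans (∑-cong λ z → trans (sym (𝟙-∧ (Z z) _))
      (cong (λ b → 𝟙 (Z z ∧ b)) (is-false (g z)))) (sym (count-def _)))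
  where
  is-true : ∀ b → b ≡ ⌊ b ≟ᵇ true ⌋
  is-true true  = refl
  is-true false = refl
  is-false : ∀ b → not b ≡ ⌊ b ≟ᵇ false ⌋
  is-false true  = refl
  is-false false = refl

*≤*⊓ : ∀ a b {c} → a ≤ c → b ≤ c → a * b ≤ c * (a ⊓ b)
*≤*⊓ a b {c} a≤c b≤c with ≤-total a b
... | inj₁ a≤b rewrite m≤n⇒m⊓n≡m a≤b = ≤-trans (≤-reflexive (*-comm a b)) (*-monoˡ-≤ a b≤c)
... | inj₂ b≤a rewrite m≥n⇒m⊓n≡n b≤a = *-monoˡ-≤ b a≤c

∫*∫-minority : (Z g : Fin n → Bool) →
  ∫ Z (λ z → 𝟙 (g z)) * ∫ Z (λ z → 𝟙 (not (g z))) ≤ count Z * minority Z g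
∫*∫-minority Z g with ∫-side Z g
... | e₁ , e₂ rewrite e₁ | e₂ = *≤*⊓ _ _ (count-mono (⊓ˢ⊑ Z _)) (count-mono (⊓ˢ⊑ Z _))

-- The functional 𝒥 is a finite sum over a second coordinate.
module TwoCoordinates {J : Set} (𝒥 : (J → ℕ) → ℕ)
  (𝒥-mono : ∀ {f g} → (∀ j → f j ≤ g j) → 𝒥 f ≤ 𝒥 g)
  (𝒥-+ : ∀ f g → 𝒥 (λ j → f j + g j) ≡ 𝒥 f + 𝒥 g)
  (X : Fin n → Bool)
  (𝒥-comm : ∀ (f : Fin n → J → ℕ) → ∫ X (λ x → 𝒥 (f x)) ≡ 𝒥 (λ j → ∫ X (λ x → f x j)))
  (f : Fin n → J → Bool) where

  size : ℕ
  size = 𝒥 λ _ → 1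

  A B : Fin n → ℕ
  A x = 𝒥 λ j → 𝟙 (f x j)
  B x = 𝒥 λ j → 𝟙 (not (f x j))

  D : Fin n → Fin n → ℕ
  D x x′ = 𝒥 λ j → 𝟙 (f x j) * 𝟙 (not (f x′ j))

  -- For an edge (x , j) and a non-edge (x′ , j′), consider (x , j′). If it is a non-edge, the pair
  -- is counted by `A x * B x`. If it is an edge, then (x , j′) and (x′ , j′) differ only in the
  -- first coordinate, and j is free, whence the factor `size`.
  A*B≤ : ∀ x x′ → A x * B x′ ≤ A x * B x + size * D x x′
  A*B≤ x x′ = begin
    A x * B x′                    ≤⟨ *-monoʳ-≤ (A x) (𝒥-mono λ j → pointwise (f x j) (f x′ j)) ⟩
    A x * 𝒥 (λ j → 𝟙 (not (f x j)) + 𝟙 (f x j) * 𝟙 (not (f x′ j))) ≡⟨ cong (A x *_) (𝒥-+ _ _) ⟩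
    A x * (B x + D x x′)          ≡⟨ *-distribˡ-+ (A x) _ _ ⟩
    A x * B x + A x * D x x′      ≤⟨ +-monoʳ-≤ _ (*-monoˡ-≤ (D x x′) (𝒥-mono λ j → 𝟙≤1 (f x j))) ⟩
    A x * B x + size * D x x′     ∎
    where
    open ≤-Reasoning
    pointwise : ∀ a b → 𝟙 (not b) ≤ 𝟙 (not a) + 𝟙 a * 𝟙 (not b)
    pointwise true  b = ≤-reflexive (sym (+-identityʳ _))
    pointwise false b = ≤-trans (𝟙≤1 (not b)) (s≤s z≤n)

  ∫∫D : ∫ X (λ x → ∫ X (D x)) ≡ 𝒥 (λ j → ∫ X (λ x → 𝟙 (f x j)) * ∫ X (λ x → 𝟙 (not (f x j))))
  ∫∫D = trans (∫-cong λ x → 𝒥-comm λ x′ j → 𝟙 (f x j) * 𝟙 (not (f x′ j)))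
    (trans (𝒥-comm λ x j → ∫ X λ x′ → 𝟙 (f x j) * 𝟙 (not (f x′ j))) (𝒥-cong λ j →
      trans (∫-cong λ x → ∫-*ˡ X (𝟙 (f x j)) _) (∫-*ʳ X _ _)))
    where
    𝒥-cong : ∀ {f g} → (∀ j → f j ≡ g j) → 𝒥 f ≡ 𝒥 g
    𝒥-cong f≡g = ≤-antisym (𝒥-mono (≤-reflexive ∘ f≡g)) (𝒥-mono (≤-reflexive ∘ sym ∘ f≡g))

  -- An edge and a non-edge are joined by a path that changes one coordinate
  -- at a time.
  ∫A*∫B≤ : ∫ X A * ∫ X B ≤ count X * ∫ X (λ x → A x * B x) +
    size * 𝒥 (λ j → ∫ X (λ x → 𝟙 (f x j)) * ∫ X (λ x → 𝟙 (not (f x j))))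
  ∫A*∫B≤ = begin
    ∫ X A * ∫ X B                                           ≡⟨ ∫-*ʳ X A _ ⟨
    ∫ X (λ x → A x * ∫ X B)                                 ≡⟨ ∫-cong (λ x → sym (∫-*ˡ X (A x) B)) ⟩
    ∫ X (λ x → ∫ X λ x′ → A x * B x′)                       ≤⟨ ∫-mono
        (λ x _ → ∫-mono λ x′ _ → A*B≤ x x′) ⟩
    ∫ X (λ x → ∫ X λ x′ → A x * B x + size * D x x′)        ≡⟨ ∫-cong
        (λ x → trans (∫-+ X _ _) (cong₂ _+_ (∫-const X _) (∫-*ˡ X size (D x)))) ⟩
    ∫ X (λ x → count X * (A x * B x) + size * ∫ X (D x))    ≡⟨ trans (∫-+ X _ _)
        (cong₂ _+_ (∫-*ˡ X (count X) _) (∫-*ˡ X size _)) ⟩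
    count X * ∫ X (λ x → A x * B x) + size * ∫ X (λ x → ∫ X (D x)) ≡⟨ cong
        (λ d → count X * ∫ X (λ x → A x * B x) + size * d) ∫∫D ⟩
    count X * ∫ X (λ x → A x * B x) + size * 𝒥 (λ j → ∫ X (λ x → 𝟙 (f x j)) * ∫ X
        (λ x → 𝟙 (not (f x j)))) ∎
    where open ≤-Reasoning

∫∫-+ : (X Y : Fin n → Bool) (f g : Fin n → Fin n → ℕ) →
  ∫ X (λ x → ∫ Y λ y → f x y + g x y) ≡ ∫ X (λ x → ∫ Y (f x)) + ∫ X (λ x → ∫ Y (g x))
∫∫-+ X Y f g = trans (∫-cong λ x → ∫-+ Y (f x) (g x)) (∫-+ X _ _)

module Triples (X Y Z : Fin n → Bool) (f : Fin n → Fin n → Fin n → Bool) where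

  triples : (Fin n → Fin n → Fin n → ℕ) → ℕ
  triples g = ∫ X λ x → ∫ Y λ y → ∫ Z λ z → g x y z

  edgeCount nonEdgeCount volume : ℕ
  edgeCount    = triples λ x y z → 𝟙 (f x y z)
  nonEdgeCount = triples λ x y z → 𝟙 (not (f x y z))
  volume       = count X * count Y * count Z

  triples-const : ∀ c → triples (λ _ _ _ → c) ≡ volume * c
  triples-const c = trans (∫-cong λ x → trans (∫-cong λ y → ∫-const Z c) (∫-const Y _))
    (trans (∫-const X _) (lemma (count X) (count Y) (count Z) c))
    where
    lemma : ∀ a b c d → a * (b * (c * d)) ≡ a * b * c * d
    lemma = solve-∀

  triples-+ : ∀ g h → triples (λ x y z → g x y z + h x y z) ≡ triples g + triples h
  triples-+ g h = trans (∫-cong λ x → ∫∫-+ Y Z (g x) (h x)) (∫-+ X _ _)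

  edges+nonEdges : edgeCount + nonEdgeCount ≡ volume
  edges+nonEdges = trans (sym (triples-+ (λ x y z → 𝟙 (f x y z)) (λ x y z → 𝟙 (not (f x y z)))))
    (trans (∫-cong λ x → ∫-cong λ y → ∫-cong λ z → lemma (f x y z))
        (trans (triples-const 1) (*-identityʳ _)))
    where
    lemma : ∀ b → 𝟙 b + 𝟙 (not b) ≡ 1
    lemma true  = refl
    lemma false = refl

  module _ (c : ℕ)
    (hz : ∀ y → c * ∫ X (λ x → minority Z (λ z → f x y z)) ≤ count X * count Z)
    (hy : ∀ z → c * ∫ X (λ x → minority Y (λ y → f x y z)) ≤ count X * count Y)
    (hx : ∀ z → c * ∫ Y (λ y → minority X (λ x → f x y z)) ≤ count Y * count X) where

    -- `TwoCoordinates` is used twice, for x against (y , z) and then, with x fixed, for y against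
    -- z. This leaves three sums over pairs of an edge and a non-edge that differ in one coordinate
    -- only; weighted by the free coordinates and by c, each is at most the square of the volume.
    edges*nonEdges≤ : c * (edgeCount * nonEdgeCount) ≤ 3 * (volume * volume)
    edges*nonEdges≤ = begin
      c * (edgeCount * nonEdgeCount)                                 ≤⟨ *-monoʳ-≤ c outer ⟩
      c * (count X * (count Y * Sz + count Z * Sy) + count Y * count Z * Sx)   ≡⟨ regroup c
          (count X) (count Y) (count Z) Sx Sy Sz ⟩
      count X * count Y * (c * Sz) + count X * count Z * (c * Sy) + count Y * count Z * (c * Sx)
        ≤⟨ +-mono-≤ (+-mono-≤ (*-monoʳ-≤ (count X * count Y) boundZ)
            (*-monoʳ-≤ (count X * count Z) boundY)) (*-monoʳ-≤ (count Y * count Z) boundX) ⟩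
      count X * count Y * (count Z * (count Y * (count X * count Z))) + count X * count Z *
          (count Y * (count Z * (count X * count Y)))
        + count Y * count Z * (count X * (count Z * (count Y * count X)))
        ≡⟨ regroup′ (count X) (count Y) (count Z) ⟩
      3 * (volume * volume) ∎
      where
      open ≤-Reasoning
      regroup : ∀ e a b c x y z → e * (a * (b * z + c * y) + b * c * x) ≡ a * b *
          (e * z) + a * c * (e * y) + b * c * (e * x)
      regroup = solve-∀
      regroup′ : ∀ a b c → a * b * (c * (b * (a * c))) + a * c * (b * (c * (a * b))) + b * c *
          (a * (c * (b * a)))
        ≡ 3 * (a * b * c * (a * b * c))
      regroup′ = solve-∀
      αβ : (W g : Fin n → Bool) → ℕ
      αβ W g = ∫ W (λ w → 𝟙 (g w)) * ∫ W (λ w → 𝟙 (not (g w)))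
      Sz Sy Sx : ℕ
      Sz = ∫ X λ x → ∫ Y λ y → αβ Z λ z → f x y z
      Sy = ∫ X λ x → ∫ Z λ z → αβ Y λ y → f x y z
      Sx = ∫ Y λ y → ∫ Z λ z → αβ X λ x → f x y z
      inner : ∀ x → (∫ Y λ y → ∫ Z λ z → 𝟙 (f x y z)) * (∫ Y λ y → ∫ Z λ z → 𝟙 (not (f x y z))) ≤
        count Y * (∫ Y λ y → αβ Z λ z → f x y z) + count Z * (∫ Z λ z → αβ Y λ y → f x y z)
      inner x = ≤-trans (TwoCoordinates.∫A*∫B≤ (∫ Z) (λ h → ∫-mono λ z _ → h z) (∫-+ Z) Y
          (∫-comm Y Z) (f x))
        (+-monoʳ-≤ _ (*-monoˡ-≤ _ (≤-reflexive (trans (∫-const Z 1) (*-identityʳ (count Z))))))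
      outer : edgeCount * nonEdgeCount ≤ count X *
          (count Y * Sz + count Z * Sy) + count Y * count Z * Sx
      outer = ≤-trans
        (TwoCoordinates.∫A*∫B≤ {J = Fin n × Fin n} (λ g → ∫ Y λ y → ∫ Z λ z → g (y , z))
          (λ h → ∫-mono λ y _ → ∫-mono λ z _ → h (y , z))
          (λ g h → ∫∫-+ Y Z (λ y z → g (y , z)) (λ y z → h (y , z))) X
          (λ g → trans (∫-comm X Y _) (∫-cong λ y → ∫-comm X Z _))
          (λ x (y , z) → f x y z))
        (+-mono-≤
          (*-monoʳ-≤ (count X) (≤-trans (∫-mono λ x _ → inner x)
            (≤-reflexive (trans (∫-+ X _ _) (cong₂ _+_ (∫-*ˡ X (count Y) _)
                (∫-*ˡ X (count Z) _))))))
          (*-monoˡ-≤ Sx (≤-reflexive (trans (∫-cong λ y → ∫-const Z 1)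
            (trans (∫-const Y _) (cong (count Y *_) (*-identityʳ _)))))))
      bound : (U V W : Fin n → Bool) (g : Fin n → Fin n → Fin n → Bool) →
        (∀ v → c * ∫ U (λ u → minority W (g u v)) ≤ count U * count W) →
        c * (∫ V λ v → ∫ U λ u → αβ W (g u v)) ≤ count W * (count V * (count U * count W))
      bound U V W g h = begin
        c * (∫ V λ v → ∫ U λ u → αβ W (g u v))                     ≤⟨ *-monoʳ-≤ c
            (∫-mono λ v _ → ∫-mono λ u _ → ∫*∫-minority W (g u v)) ⟩
        c * (∫ V λ v → ∫ U λ u → count W * minority W (g u v))     ≡⟨ cong (c *_)
            (trans (∫-cong λ v → ∫-*ˡ U (count W) _) (∫-*ˡ V (count W) _)) ⟩
        c * (count W * ∫ V λ v → ∫ U λ u → minority W (g u v))     ≡⟨ swap c (count W) _ ⟩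
        count W * (c * ∫ V λ v → ∫ U λ u → minority W (g u v))     ≡⟨ cong (count W *_)
            (sym (∫-*ˡ V c _)) ⟩
        count W * (∫ V λ v → c * ∫ U λ u → minority W (g u v))     ≤⟨ *-monoʳ-≤ (count W)
            (≤-trans (∫-mono λ v _ → h v) (≤-reflexive (∫-const V _))) ⟩
        count W * (count V * (count U * count W))                  ∎
        where
        swap : ∀ a b c → a * (b * c) ≡ b * (a * c)
        swap = solve-∀
      boundZ : c * Sz ≤ count Z * (count Y * (count X * count Z))
      boundZ = ≤-trans (≤-reflexive (cong (c *_) (∫-comm X Y _)))
          (bound X Y Z (λ x y z → f x y z) hz)
      boundY : c * Sy ≤ count Y * (count Z * (count X * count Y))
      boundY = ≤-trans (≤-reflexive (cong (c *_) (∫-comm X Z _)))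
          (bound X Z Y (λ x z y → f x y z) hy)
      boundX : c * Sx ≤ count X * (count Z * (count Y * count X))
      boundX = ≤-trans (≤-reflexive (cong (c *_) (∫-comm Y Z _)))
          (bound Y Z X (λ y z x → f x y z) hx)

-- As a + b ≤ 2b, a factor 6b cancels; a = 0 is treated apart to keep b positive. The 12 in
-- `threshold` originates here: 3 for the three coordinates, 2 for this estimate, and 2 to keep half
-- of the error for the passage to a close 3-graph.
smaller-small : ∀ e a b → a ≤ b → 12 * e * (a * b) ≤ 3 * ((a + b) * (a + b)) → 2 * e * a ≤ a + b
smaller-small e zero      b         _   _ = ≤-trans (≤-reflexive (*-zeroʳ (2 * e))) z≤n
smaller-small e a@(suc _) b@(suc _) a≤b h = *-cancelˡ-≤ (6 * b) (begin
  6 * b * (2 * e * a)             ≡⟨ lemma b e a ⟩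
  12 * e * (a * b)                ≤⟨ h ⟩
  3 * ((a + b) * (a + b))         ≤⟨ *-monoʳ-≤ 3 (*-monoˡ-≤ (a + b) (+-monoˡ-≤ b a≤b)) ⟩
  3 * ((b + b) * (a + b))         ≡⟨ lemma′ b (a + b) ⟩
  6 * b * (a + b)                 ∎)
  where
  open ≤-Reasoning
  lemma : ∀ b e a → 6 * b * (2 * e * a) ≡ 12 * e * (a * b)
  lemma = solve-∀
  lemma′ : ∀ b v → 3 * ((b + b) * v) ≡ 6 * b * v
  lemma′ = solve-∀

⊓-small : ∀ e a b {v} → a + b ≡ v → 12 * e * (a * b) ≤ 3 * (v * v) →
  2 * e * a ≤ v ⊎ 2 * e * b ≤ v
⊓-small e a b refl h with ≤-total a b
... | inj₁ a≤b = inj₁ (smaller-small e a b a≤b h)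
... | inj₂ b≤a = inj₂ (≤-trans (smaller-small e b a b≤a
  (≤-trans (≤-reflexive (cong (12 * e *_) (*-comm b a)))
    (≤-trans h (≤-reflexive (cong (λ v → 3 * (v * v)) (+-comm a b))))))
  (≤-reflexive (+-comm b a)))

-- Families of sets

opaque
  ∑ˢ : (Subset n → ℕ) → ℕ
  ∑ˢ {zero}  f = f []
  ∑ˢ {suc n} f = ∑ˢ (f ∘ (inside ∷_)) + ∑ˢ (f ∘ (outside ∷_))

  ∑ˢ-mono : {f g : Subset n → ℕ} → (∀ e → f e ≤ g e) → ∑ˢ f ≤ ∑ˢ g
  ∑ˢ-mono {zero}  f≤g = f≤g []
  ∑ˢ-mono {suc n} f≤g = +-mono-≤ (∑ˢ-mono (f≤g ∘ (inside ∷_))) (∑ˢ-mono (f≤g ∘ (outside ∷_)))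

  ∑ˢ-∑ : (f : Subset n → Fin t → ℕ) → ∑ˢ (λ e → ∑ (f e)) ≡ ∑ (λ i → ∑ˢ (λ e → f e i))
  ∑ˢ-∑ {zero}  f = refl
  ∑ˢ-∑ {suc n} f = trans (cong₂ _+_ (∑ˢ-∑ (f ∘ (inside ∷_))) (∑ˢ-∑ (f ∘ (outside ∷_))))
      (sym (∑-+ _ _))

  ∑ˢ-zero : (f : Subset n → ℕ) → (∀ e → f e ≡ 0) → ∑ˢ f ≡ 0
  ∑ˢ-zero {zero}  f f≡0 = f≡0 []
  ∑ˢ-zero {suc n} f f≡0 = cong₂ _+_ (∑ˢ-zero _ (f≡0 ∘ (inside ∷_))) (∑ˢ-zero _ (f≡0 ∘ (outside ∷_)))

  ∑ˢ-single : ∀ e₀ (f : Subset n → ℕ) → (∀ e → e ≢ e₀ → f e ≡ 0) → ∑ˢ f ≡ f e₀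
  ∑ˢ-single []            f f≡0 = refl
  ∑ˢ-single (inside ∷ e)  f f≡0 = trans (cong₂ _+_
    (∑ˢ-single e _ λ e′ e′≢e → f≡0 (inside ∷ e′) (e′≢e ∘ ∷-injectiveʳ))
    (∑ˢ-zero _ λ e′ → f≡0 (outside ∷ e′) λ ())) (+-identityʳ _)
  ∑ˢ-single (outside ∷ e) f f≡0 = cong₂ _+_
    (∑ˢ-zero _ λ e′ → f≡0 (inside ∷ e′) λ ())
    (∑ˢ-single e _ λ e′ e′≢e → f≡0 (outside ∷ e′) (e′≢e ∘ ∷-injectiveʳ))

  card≡∑ˢ : (F : Family n) → card F ≡ ∑ˢ (𝟙 ∘ F)
  card≡∑ˢ {zero} F with F []
  ... | true  = refl
  ... | false = refl
  card≡∑ˢ {suc n} F = trans (cong length (filter-++ (T? ∘ F) (List.map (inside ∷_) (subsets n)) _))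
    (trans (length-++ (filterᵇ F (List.map (inside ∷_) (subsets n))))
      (cong₂ _+_ (trans (length-filter-map (inside ∷_) (subsets n)) (card≡∑ˢ (F ∘ (inside ∷_))))
                 (trans (length-filter-map (outside ∷_) (subsets n)) (card≡∑ˢ (F ∘ (outside ∷_))))))
    where
    length-filter-map : ∀ (f : Subset n → Subset (suc n)) xs →
      length (filterᵇ F (List.map f xs)) ≡ length (filterᵇ (F ∘ f) xs)
    length-filter-map f []       = refl
    length-filter-map f (x ∷ xs) with F (f x)
    ... | true  = cong suc (length-filter-map f xs)
    ... | false = length-filter-map f xs

card-mono : {F F′ : Family n} → (∀ e → e ∈ᶠ F → e ∈ᶠ F′) → card F ≤ card F′
card-mono {F = F} {F′} sub = ≤-trans (≤-reflexive (card≡∑ˢ F))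
  (≤-trans (∑ˢ-mono λ e → 𝟙-mono (F e) (F′ e) (sub e)) (≤-reflexive (sym (card≡∑ˢ F′))))

opaque
  unfolding count ∑

  ∣∣≡count : (X : Subset n) → ∣ X ∣ ≡ count (lookup X)
  ∣∣≡count []            = refl
  ∣∣≡count (inside ∷ X)  = cong suc (∣∣≡count X)
  ∣∣≡count (outside ∷ X) = ∣∣≡count X

∈⇒T : ∀ {x} {X : Subset n} → x ∈ X → T (lookup X x)
∈⇒T p = ≡true⇒T ([]=⇒lookup p)

T⇒∈ : ∀ {x} (X : Subset n) → T (lookup X x) → x ∈ X
T⇒∈ X p = lookup⇒[]= _ X (T⇒≡true p)

infix 4 _#_
_#_ : Subset n → Subset n → Set
X # Y = ∀ {x} → x ∈ X → ¬ x ∈ Y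

Triple-swap₁₂ : (x y z : Fin n) → Triple x y z ≡ Triple y x z
Triple-swap₁₂ x y z = trans (sym (∪-assoc ⁅ x ⁆ ⁅ y ⁆ ⁅ z ⁆))
    (trans (cong (_∪ ⁅ z ⁆) (∪-comm ⁅ x ⁆ ⁅ y ⁆)) (∪-assoc ⁅ y ⁆ ⁅ x ⁆ ⁅ z ⁆))

Triple-swap₂₃ : (x y z : Fin n) → Triple x y z ≡ Triple x z y
Triple-swap₂₃ x y z = cong (⁅ x ⁆ ∪_) (∪-comm ⁅ y ⁆ ⁅ z ⁆)

Triple-first : (x y z : Fin n) → x ∈ Triple x y z
Triple-first x y z = x∈p∪q⁺ (inj₁ (x∈⁅x⁆ x))

∈-Triple : ∀ {w x y z : Fin n} → w ∈ Triple x y z → w ≡ x ⊎ w ≡ y ⊎ w ≡ z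
∈-Triple {x = x} {y} {z} p with x∈p∪q⁻ ⁅ x ⁆ _ p
... | inj₁ q = inj₁ (x∈⁅y⁆⇒x≡y x q)
... | inj₂ q with x∈p∪q⁻ ⁅ y ⁆ ⁅ z ⁆ q
...   | inj₁ r = inj₂ (inj₁ (x∈⁅y⁆⇒x≡y y r))
...   | inj₂ r = inj₂ (inj₂ (x∈⁅y⁆⇒x≡y z r))

module _ (X Y Z : Subset n) (X#Y : X # Y) (Y#Z : Y # Z) (X#Z : X # Z) where

  Triple-injective : ∀ {x y z x′ y′ z′} → x ∈ X → y ∈ Y → z ∈ Z → x′ ∈ X → y′ ∈ Y → z′ ∈ Z →
    Triple x y z ≡ Triple x′ y′ z′ → x ≡ x′ × y ≡ y′ × z ≡ z′
  Triple-injective {x} {y} {z} {x′} {y′} {z′} xX yY zZ x′X y′Y z′Z eq =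
    fromX (∈-Triple (subst (x ∈_) eq (Triple-first x y z))) ,
    fromY (∈-Triple (subst (y ∈_) (trans (sym (Triple-swap₁₂ x y z)) eq) (Triple-first y x z))) ,
    fromZ (∈-Triple (subst (z ∈_) (trans (trans (sym (Triple-swap₁₂ x z y))
        (sym (Triple-swap₂₃ x y z))) eq) (Triple-first z x y)))
    where
    fromX : x ≡ x′ ⊎ x ≡ y′ ⊎ x ≡ z′ → x ≡ x′
    fromX (inj₁ e)           = e
    fromX (inj₂ (inj₁ refl)) = contradiction y′Y (X#Y xX)
    fromX (inj₂ (inj₂ refl)) = contradiction z′Z (X#Z xX)
    fromY : y ≡ x′ ⊎ y ≡ y′ ⊎ y ≡ z′ → y ≡ y′
    fromY (inj₁ refl)        = contradiction yY (X#Y x′X)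
    fromY (inj₂ (inj₁ e))    = e
    fromY (inj₂ (inj₂ refl)) = contradiction z′Z (Y#Z yY)
    fromZ : z ≡ x′ ⊎ z ≡ y′ ⊎ z ≡ z′ → z ≡ z′
    fromZ (inj₁ refl)        = contradiction zZ (X#Z x′X)
    fromZ (inj₂ (inj₁ refl)) = contradiction zZ (Y#Z y′Y)
    fromZ (inj₂ (inj₂ e))    = e

  inK₃-intro : ∀ {x y z} → x ∈ X → y ∈ Y → z ∈ Z → InK₃ X Y Z (Triple x y z)
  inK₃-intro {x} {y} {z} xX yY zZ = x , y , z , (xX , yY , zZ) ,
    ((λ { refl → X#Y xX yY }) , (λ { refl → Y#Z yY zZ }) , (λ { refl → X#Z xX zZ })) , refl

  module _ (F : Family n) where

    term? : ∀ e x y z → Dec ((T (lookup X x) × T (lookup Y y) × T (lookup Z z)) × e ≡ Triple x y z)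
    term? e x y z = (T? _ ×-dec T? _ ×-dec T? _) ×-dec ≡-dec _≟ᵇ_ e (Triple x y z)

    term : Subset n → Fin n → Fin n → Fin n → ℕ
    term e x y z = 𝟙 ⌊ term? e x y z ⌋ * 𝟙 (F e)

    term-none : ∀ e x y z → ¬ ((T (lookup X x) × T (lookup Y y) × T (lookup Z z)) × e ≡
        Triple x y z) → term e x y z ≡ 0
    term-none e x y z h = cong (_* 𝟙 (F e)) (𝟙-false ⌊ term? e x y z ⌋
        (h ∘ ⌊⌋-elim (term? e x y z)))

    ∑-none : ∀ {m} (f : Fin m → ℕ) → (∀ i → f i ≡ 0) → ∑ f ≡ 0
    ∑-none {m} f f≡0 = trans (∑-cong f≡0) (trans (∑-const m 0) (*-zeroʳ m))

    -- Since X, Y and Z are disjoint, a member of K₃ determines its x, y and z, so exactly one term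
    -- of the triple sum survives.
    𝟙-∩-K₃ : ∀ e → 𝟙 ((F ∩ᶠ K₃[ X , Y , Z ]) e) ≡ ∑ λ x → ∑ λ y → ∑ λ z → term e x y z
    𝟙-∩-K₃ e = trans (𝟙-∧ (F e) _) (go (inK₃? X Y Z e))
      where
      go : (d : Dec (InK₃ X Y Z e)) → 𝟙 (F e) * 𝟙 ⌊ d ⌋ ≡ ∑ λ x → ∑ λ y → ∑ λ z → term e x y z
      go (no ¬K) = trans (*-zeroʳ (𝟙 (F e))) (sym (∑-none _ λ x → ∑-none _ λ y → ∑-none _ λ z →
        term-none e x y z λ { ((p , q , r) , refl) → ¬K
            (inK₃-intro (T⇒∈ X p) (T⇒∈ Y q) (T⇒∈ Z r)) }))
      go (yes (x , y , z , (xX , yY , zZ) , _ , refl)) = trans (*-comm (𝟙 (F e)) 1) (sym (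
        trans (∑-single x _ λ x′ x′≢ → ∑-none _ λ y′ → ∑-none _ λ z′ → term-none e x′ y′ z′
                λ { ((p , q , r) , eq) → x′≢ (sym (proj₁ (unique p q r eq))) })
       (trans (∑-single y _ λ y′ y′≢ → ∑-none _ λ z′ → term-none e x y′ z′
                λ { ((p , q , r) , eq) → y′≢ (sym (proj₁ (proj₂ (unique p q r eq)))) })
       (trans (∑-single z _ λ z′ z′≢ → term-none e x y z′
                λ { ((p , q , r) , eq) → z′≢ (sym (proj₂ (proj₂ (unique p q r eq)))) })
         (cong (_* 𝟙 (F e)) (𝟙-true ⌊ term? e x y z ⌋
             (⌊⌋-intro (term? e x y z) ((∈⇒T xX , ∈⇒T yY , ∈⇒T zZ) , refl))))))))
        where
        unique : ∀ {x′ y′ z′} → T (lookup X x′) → T (lookup Y y′) → T (lookup Z z′) →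
          Triple x y z ≡ Triple x′ y′ z′ → x ≡ x′ × y ≡ y′ × z ≡ z′
        unique p q r = Triple-injective xX yY zZ (T⇒∈ X p) (T⇒∈ Y q) (T⇒∈ Z r)

    card-K₃ : card (F ∩ᶠ K₃[ X , Y , Z ]) ≡
      Triples.edgeCount (lookup X) (lookup Y) (lookup Z) (λ x y z → F (Triple x y z))
    card-K₃ = begin
      card (F ∩ᶠ K₃[ X , Y , Z ])                                     ≡⟨ card≡∑ˢ _ ⟩
      ∑ˢ (𝟙 ∘ (F ∩ᶠ K₃[ X , Y , Z ]))                                 ≡⟨ ∑ˢ-cong 𝟙-∩-K₃ ⟩
      ∑ˢ (λ e → ∑ λ x → ∑ λ y → ∑ λ z → term e x y z)                 ≡⟨ trans (∑ˢ-∑ _)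
          (∑-cong λ x → trans (∑ˢ-∑ _) (∑-cong λ y → ∑ˢ-∑ _)) ⟩
      ∑ (λ x → ∑ λ y → ∑ λ z → ∑ˢ λ e → term e x y z)                 ≡⟨ ∑-cong
          (λ x → ∑-cong λ y → ∑-cong λ z → perTriple x y z) ⟩
      ∑ (λ x → ∑ λ y → ∑ λ z → 𝟙 (lookup X x) * (𝟙 (lookup Y y) *
          (𝟙 (lookup Z z) * 𝟙 (F (Triple x y z)))))
        ≡⟨ ∑-cong (λ x → trans (∑-cong λ y → trans (∑-*ˡ (𝟙 (lookup X x)) _)
            (cong (𝟙 (lookup X x) *_) (trans (∑-*ˡ (𝟙 (lookup Y y)) _)
                (cong (𝟙 (lookup Y y) *_) (sym (∫-def (lookup Z) _))))))
            (trans (∑-*ˡ (𝟙 (lookup X x)) _) (cong (𝟙 (lookup X x) *_)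
                (sym (∫-def (lookup Y) _))))) ⟩
      ∑ (λ x → 𝟙 (lookup X x) * ∫ (lookup Y) λ y → ∫ (lookup Z) λ z → 𝟙 (F (Triple x y z)))  ≡⟨
          ∫-def (lookup X) _ ⟨
      Triples.edgeCount (lookup X) (lookup Y) (lookup Z) (λ x y z → F (Triple x y z))        ∎
      where
      open ≡-Reasoning
      ∑ˢ-cong : {f g : Subset n → ℕ} → (∀ e → f e ≡ g e) → ∑ˢ f ≡ ∑ˢ g
      ∑ˢ-cong f≡g = ≤-antisym (∑ˢ-mono λ e → ≤-reflexive (f≡g e))
          (∑ˢ-mono λ e → ≤-reflexive (sym (f≡g e)))
      perTriple : ∀ x y z → ∑ˢ (λ e → term e x y z) ≡
        𝟙 (lookup X x) * (𝟙 (lookup Y y) * (𝟙 (lookup Z z) * 𝟙 (F (Triple x y z))))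
      perTriple x y z = trans (∑ˢ-single (Triple x y z) _ (λ e ne → term-none e x y z (ne ∘ proj₂)))
        (trans (cong (_* 𝟙 (F (Triple x y z))) (product (lookup X x) (lookup Y y) (lookup Z z)
            (term? (Triple x y z) x y z)))
          (assoc (𝟙 (lookup X x)) (𝟙 (lookup Y y)) (𝟙 (lookup Z z)) _))
        where
        assoc : ∀ a b c d → a * b * c * d ≡ a * (b * (c * d))
        assoc = solve-∀
        product : ∀ a b c (d : Dec ((T a × T b × T c) × Triple x y z ≡ Triple x y z)) → 𝟙 ⌊ d ⌋ ≡
            𝟙 a * 𝟙 b * 𝟙 c
        product true  true  true  d = 𝟙-true ⌊ d ⌋ (⌊⌋-intro d (_ , refl))
        product true  true  false d = 𝟙-false ⌊ d ⌋ (proj₂ ∘ proj₂ ∘ proj₁ ∘ ⌊⌋-elim d)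
        product true  false c     d = 𝟙-false ⌊ d ⌋ (proj₁ ∘ proj₂ ∘ proj₁ ∘ ⌊⌋-elim d)
        product false b     c     d = 𝟙-false ⌊ d ⌋ (proj₁ ∘ proj₁ ∘ ⌊⌋-elim d)

∣Pair∣≡2 : (i j : Fin n) → i ≢ j → ∣ Pair i j ∣ ≡ 2
∣Pair∣≡2 zero    zero    ne = contradiction refl ne
∣Pair∣≡2 zero    (suc j) ne = cong suc (trans (cong ∣_∣ (∪-identityˡ ⁅ j ⁆)) (∣⁅x⁆∣≡1 j))
∣Pair∣≡2 (suc i) zero    ne = cong suc (trans (cong ∣_∣ (∪-identityʳ ⁅ i ⁆)) (∣⁅x⁆∣≡1 i))
∣Pair∣≡2 (suc i) (suc j) ne = ∣Pair∣≡2 i j (ne ∘ cong suc)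

-- Badness depends on the order of the two parts; an unordered pair is excluded if either order is
-- bad, so there are at most as many pairs as bad ordered ones.
module PairSet (bad : Fin t → Fin t → Bool) where

  pair? : ∀ e i j → Dec (T (bad i j) × i ≢ j × e ≡ Pair i j)
  pair? e i j = T? (bad i j) ×-dec ¬? (i ≟ᶠ j) ×-dec ≡-dec _≟ᵇ_ e (Pair i j)

  isPair? : ∀ e → Dec (∃[ i ] ∃[ j ] T (bad i j) × i ≢ j × e ≡ Pair i j)
  isPair? e = any? λ i → any? λ j → pair? e i j

  pairs : Uniform 2 t
  pairs = record
    { edges   = λ e → ⌊ isPair? e ⌋
    ; uniform = λ e p → let i , j , _ , i≢j , eq = ⌊⌋-elim (isPair? e) p in trans (cong ∣_∣ eq) (∣Pair∣≡2 i j i≢j)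
    }

  Pair∉ : ∀ i j → i ≢ j → Pair i j ∉ᶠ edges pairs → ¬ T (bad i j) × ¬ T (bad j i)
  Pair∉ i j i≢j ∉ = (λ b → ∉ (⌊⌋-intro (isPair? (Pair i j)) (i , j , b , i≢j , refl))) ,
    (λ b → ∉ (⌊⌋-intro (isPair? (Pair i j)) (j , i , b , i≢j ∘ sym , ∪-comm ⁅ i ⁆ ⁅ j ⁆)))

  card-pairs : card (edges pairs) ≤ ∑ λ i → ∑ λ j → 𝟙 (bad i j)
  card-pairs = begin
    card (edges pairs)                                    ≡⟨ card≡∑ˢ _ ⟩
    ∑ˢ (𝟙 ∘ edges pairs)                                  ≤⟨ ∑ˢ-mono perSet ⟩
    ∑ˢ (λ e → ∑ λ i → ∑ λ j → 𝟙 ⌊ pair? e i j ⌋)          ≡⟨ trans (∑ˢ-∑ _) (∑-cong λ i → ∑ˢ-∑ _) ⟩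
    ∑ (λ i → ∑ λ j → ∑ˢ λ e → 𝟙 ⌊ pair? e i j ⌋)          ≤⟨ ∑-mono
        (λ i → ∑-mono λ j → perPair i j) ⟩
    ∑ (λ i → ∑ λ j → 𝟙 (bad i j))                         ∎
    where
    open ≤-Reasoning
    perSet : ∀ e → 𝟙 ⌊ isPair? e ⌋ ≤ ∑ λ i → ∑ λ j → 𝟙 ⌊ pair? e i j ⌋
    perSet e = go (isPair? e)
      where
      go : (d : Dec (∃[ i ] ∃[ j ] T (bad i j) × i ≢ j × e ≡ Pair i j)) → 𝟙 ⌊ d ⌋ ≤ ∑ λ i →
          ∑ λ j → 𝟙 ⌊ pair? e i j ⌋
      go (no _)            = z≤n
      go (yes (i , j , p)) = ≤-trans (≤-reflexive (sym
          (𝟙-true ⌊ pair? e i j ⌋ (⌊⌋-intro (pair? e i j) p))))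
        (≤-trans (≤-∑ (λ j → 𝟙 ⌊ pair? e i j ⌋) j) (≤-∑ (λ i → ∑ λ j → 𝟙 ⌊ pair? e i j ⌋) i))
    perPair : ∀ i j → ∑ˢ (λ e → 𝟙 ⌊ pair? e i j ⌋) ≤ 𝟙 (bad i j)
    perPair i j = ≤-trans (≤-reflexive (∑ˢ-single (Pair i j) _ λ e ne → 𝟙-false _
        (ne ∘ proj₂ ∘ proj₂ ∘ ⌊⌋-elim (pair? e i j))))
      (𝟙-mono _ (bad i j) (proj₁ ∘ ⌊⌋-elim (pair? (Pair i j) i j)))

-- Rational bounds from inequalities between natural numbers

toℚᵘ-⌜⌝ : ∀ a → toℚᵘ ⌜ a ⌝ ℚᵘ.≃ mkℚᵘ (ℤ.+ a) 0
toℚᵘ-⌜⌝ a = ℚₚ.toℚᵘ-fromℚᵘ (mkℚᵘ (ℤ.+ a) 0)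

toℚᵘ-*⌜⌝ : ∀ p b → toℚᵘ (p ℚ.* ⌜ b ⌝) ℚᵘ.≃ toℚᵘ p ℚᵘ.* mkℚᵘ (ℤ.+ b) 0
toℚᵘ-*⌜⌝ p b = ℚᵘₚ.≃-trans (ℚₚ.toℚᵘ-homo-* p ⌜ b ⌝) (ℚᵘₚ.*-congˡ {toℚᵘ p} (toℚᵘ-⌜⌝ b))

⌜⌝-mono : ∀ {a b} → a ≤ b → ⌜ a ⌝ ℚ.≤ ⌜ b ⌝
⌜⌝-mono {a} {b} a≤b = ℚₚ.toℚᵘ-cancel-≤ (ℚᵘₚ.≤-respˡ-≃ (ℚᵘₚ.≃-sym (toℚᵘ-⌜⌝ a))
    (ℚᵘₚ.≤-respʳ-≃ (ℚᵘₚ.≃-sym (toℚᵘ-⌜⌝ b))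
  (*≤* (ℤₚ.*-monoʳ-≤-nonNeg (ℤ.+ 1) (ℤ.+≤+ a≤b)))))

⌜⌝-+ : ∀ a b → ⌜ a + b ⌝ ≡ ⌜ a ⌝ ℚ.+ ⌜ b ⌝
⌜⌝-+ a b = ℚₚ.toℚᵘ-injective (begin
  toℚᵘ ⌜ a + b ⌝                      ≈⟨ toℚᵘ-⌜⌝ (a + b) ⟩
  mkℚᵘ (ℤ.+ (a + b)) 0                  ≈⟨ *≡* (cong (ℤ._* ℤ.+ 1)
      (trans (ℤₚ.pos-+ a b) (cong₂ ℤ._+_ (sym (ℤₚ.*-identityʳ (ℤ.+ a)))
          (sym (ℤₚ.*-identityʳ (ℤ.+ b)))))) ⟩
  mkℚᵘ (ℤ.+ a) 0 ℚᵘ.+ mkℚᵘ (ℤ.+ b) 0      ≈⟨ ℚᵘₚ.+-cong (toℚᵘ-⌜⌝ a) (toℚᵘ-⌜⌝ b) ⟨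
  toℚᵘ ⌜ a ⌝ ℚᵘ.+ toℚᵘ ⌜ b ⌝          ≈⟨ ℚₚ.toℚᵘ-homo-+ ⌜ a ⌝ ⌜ b ⌝ ⟨
  toℚᵘ (⌜ a ⌝ ℚ.+ ⌜ b ⌝)              ∎)
  where open ℚᵘₚ.≃-Reasoning

Scale : ℚ → ℕ → Set
Scale ε e = ∀ a b → e * a ≤ b → ⌜ a ⌝ ℚ.≤ ε ℚ.* ⌜ b ⌝

-- A positive ε has numerator at least 1, so it is at least the reciprocal of its denominator. This
-- lets the combinatorial part work with natural numbers alone.
⌜⌝-≤-* : ∀ ε → 0ℚ ℚ.< ε → Scale ε (↧ₙ ε)
⌜⌝-≤-* (mkℚ (ℤ.+ zero) d _) (ℚ.*<* (ℤ.+<+ ())) a b h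
⌜⌝-≤-* ε@(mkℚ (ℤ.+ p@(suc _)) d _) ε>0 a b h = ℚₚ.toℚᵘ-cancel-≤
    (ℚᵘₚ.≤-respˡ-≃ (ℚᵘₚ.≃-sym (toℚᵘ-⌜⌝ a))
  (ℚᵘₚ.≤-respʳ-≃ (ℚᵘₚ.≃-sym (toℚᵘ-*⌜⌝ ε b)) (*≤* (begin
    ℤ.+ a ℤ.* ℤ.+ (suc d * 1)    ≡⟨ ℤₚ.pos-* a (suc d * 1) ⟨
    ℤ.+ (a * (suc d * 1))      ≤⟨ ℤ.+≤+ bound ⟩
    ℤ.+ (p * b * 1)            ≡⟨ trans (ℤₚ.pos-* (p * b) 1) (cong (ℤ._* ℤ.+ 1) (ℤₚ.pos-* p b)) ⟩
    (ℤ.+ p ℤ.* ℤ.+ b) ℤ.* ℤ.+ 1    ∎))))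
  where
  open ℤₚ.≤-Reasoning
  bound : a * (suc d * 1) ≤ p * b * 1
  bound = ≤-trans (≤-reflexive (trans (cong (a *_) (*-identityʳ (suc d))) (*-comm a (suc d))))
    (≤-trans h (≤-trans (≤-reflexive (sym (*-identityˡ b)))
        (≤-trans (*-monoˡ-≤ b {1} {p} (s≤s z≤n)) (≤-reflexive (sym (*-identityʳ (p * b)))))))
⌜⌝-≤-* (mkℚ ℤ.-[1+ p ] d _) (ℚ.*<* ()) a b h

≤-*-⌜⌝ : ∀ D .{{_ : NonZero D}} a b → ⌜ a ⌝ ℚ.≤ (ℤ.+ 1 ℚ./ D) ℚ.* ⌜ b ⌝ → D * a ≤ b
≤-*-⌜⌝ (suc d) a b h = bound (ℤₚ.drop‿+≤+ (unwrap (ℚᵘₚ.≤-respˡ-≃ (toℚᵘ-⌜⌝ a) (ℚᵘₚ.≤-respʳ-≃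
    (ℚᵘₚ.≃-trans (toℚᵘ-*⌜⌝ (ℤ.+ 1 ℚ./ suc d) b) (ℚᵘₚ.*-congʳ {mkℚᵘ (ℤ.+ b) 0}
        (ℚₚ.toℚᵘ-fromℚᵘ (mkℚᵘ (ℤ.+ 1) d))))
    (ℚₚ.toℚᵘ-mono-≤ h)))))
  where
  unwrap : mkℚᵘ (ℤ.+ a) 0 ℚᵘ.≤ mkℚᵘ (ℤ.+ 1) d ℚᵘ.* mkℚᵘ (ℤ.+ b) 0 → ℤ.+ (a * (suc d * 1)) ℤ.≤ ℤ.+
      (1 * b * 1)
  unwrap (*≤* le) = ℤₚ.≤-trans (ℤₚ.≤-reflexive (ℤₚ.pos-* a (suc d * 1)))
      (ℤₚ.≤-trans le (ℤₚ.≤-reflexive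
    (sym (trans (ℤₚ.pos-* (1 * b) 1) (cong (ℤ._* ℤ.+ 1) (ℤₚ.pos-* 1 b))))))
  bound : a * (suc d * 1) ≤ 1 * b * 1 → suc d * a ≤ b
  bound le = ≤-trans (≤-reflexive (trans (*-comm (suc d) a)
      (cong (a *_) (sym (*-identityʳ (suc d))))))
    (≤-trans le (≤-reflexive (trans (*-identityʳ (1 * b)) (*-identityˡ b))))

1/>0 : ∀ D .{{_ : NonZero D}} → 0ℚ ℚ.< ℤ.+ 1 ℚ./ D
1/>0 D = ℚₚ.positive⁻¹ (ℤ.+ 1 ℚ./ D) {{ℚₚ.normalize-pos 1 D}}

density : ∀ a u .{{_ : NonZero u}} → (ℤ.+ a ℚ./ u) ℚ.* ⌜ u ⌝ ≡ ⌜ a ⌝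
density a u@(suc v) = ℚₚ.toℚᵘ-injective (begin
  toℚᵘ ((ℤ.+ a ℚ./ u) ℚ.* ⌜ u ⌝)       ≈⟨ toℚᵘ-*⌜⌝ (ℤ.+ a ℚ./ u) u ⟩
  toℚᵘ (ℤ.+ a ℚ./ u) ℚᵘ.* mkℚᵘ (ℤ.+ u) 0 ≈⟨ ℚᵘₚ.*-congʳ {mkℚᵘ (ℤ.+ u) 0}
      (ℚₚ.toℚᵘ-fromℚᵘ (mkℚᵘ (ℤ.+ a) v)) ⟩
  mkℚᵘ (ℤ.+ a) v ℚᵘ.* mkℚᵘ (ℤ.+ u) 0     ≈⟨ *≡* (trans (ℤₚ.*-identityʳ _)
      (cong (λ k → ℤ.+ a ℤ.* ℤ.+ k) (sym (*-identityʳ u)))) ⟩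
  mkℚᵘ (ℤ.+ a) 0                       ≈⟨ toℚᵘ-⌜⌝ a ⟨
  toℚᵘ ⌜ a ⌝                         ∎)
  where open ℚᵘₚ.≃-Reasoning

-‿≤ : ∀ {x y E : ℚ} → 0ℚ ℚ.≤ y → x ℚ.≤ E → x ℚ.- y ℚ.≤ E
-‿≤ {x} {y} {E} 0≤y x≤E = ℚₚ.≤-trans (ℚₚ.+-monoʳ-≤ x (ℚₚ.neg-antimono-≤ 0≤y))
  (ℚₚ.≤-trans (ℚₚ.≤-reflexive (ℚₚ.+-identityʳ x)) x≤E)

∣-∣≤ : ∀ {x y E : ℚ} → 0ℚ ℚ.≤ x → x ℚ.≤ E → 0ℚ ℚ.≤ y → y ℚ.≤ E → ℚ.∣ x ℚ.- y ∣ ℚ.≤ E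
∣-∣≤ {x} {y} {E} 0≤x x≤E 0≤y y≤E with ℚₚ.∣p∣≡p∨∣p∣≡-p (x ℚ.- y)
... | inj₁ eq = ℚₚ.≤-trans (ℚₚ.≤-reflexive eq) (-‿≤ 0≤y x≤E)
... | inj₂ eq = ℚₚ.≤-trans (ℚₚ.≤-reflexive (trans eq
    (solve 2 (λ x y → :- (x :- y) := y :- x) refl x y))) (-‿≤ 0≤x y≤E)
  where open +-*-Solver

-- a and b count edges and non-edges of a triple of volume u, and a′, b′, u′
-- those of a subtriple.
discrepancy : ∀ {ε e} → Scale ε e → ∀ {a b u a′ b′ u′} .{{_ : NonZero u}} →
  a + b ≡ u → a′ + b′ ≡ u′ → a′ ≤ a → b′ ≤ b → e * a ≤ u ⊎ e * b ≤ u →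
  ℚ.∣ ⌜ a′ ⌝ ℚ.- (ℤ.+ a ℚ./ u) ℚ.* ⌜ u′ ⌝ ∣ ℚ.≤ ε ℚ.* ⌜ u ⌝
discrepancy {ε} {e} scale {a} {b} {u} {a′} {b′} {u′} refl refl a′≤a b′≤b small = go small
  where
  d : ℚ
  d = ℤ.+ a ℚ./ u
  instance
    d≥0 : ℚ.NonNegative d
    d≥0 = ℚₚ.normalize-nonNeg a u
  E : ℚ
  E = ε ℚ.* ⌜ u ⌝
  open +-*-Solver
  ⌜⌝≥0 : ∀ x → 0ℚ ℚ.≤ ⌜ x ⌝
  ⌜⌝≥0 x = ⌜⌝-mono (z≤n {x})
  d*≤ : ∀ {x y} → x ≤ y → d ℚ.* ⌜ x ⌝ ℚ.≤ d ℚ.* ⌜ y ⌝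
  d*≤ x≤y = ℚₚ.*-monoˡ-≤-nonNeg d (⌜⌝-mono x≤y)
  d*≥0 : ∀ x → 0ℚ ℚ.≤ d ℚ.* ⌜ x ⌝
  d*≥0 x = ℚₚ.≤-trans (ℚₚ.≤-reflexive (sym (ℚₚ.*-zeroʳ d))) (ℚₚ.*-monoˡ-≤-nonNeg d (⌜⌝≥0 x))
  u′≤u : u′ ≤ u
  u′≤u = +-mono-≤ a′≤a b′≤b
  d≤1 : d ℚ.≤ 1ℚ
  d≤1 = ℚₚ.*-cancelʳ-≤-pos ⌜ u ⌝ {{ℚₚ.normalize-pos u 1}} (ℚₚ.≤-trans (ℚₚ.≤-reflexive (density a u))
    (ℚₚ.≤-trans (⌜⌝-mono (m≤m+n a b)) (ℚₚ.≤-reflexive (sym (ℚₚ.*-identityˡ ⌜ u ⌝)))))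
  c : ℚ
  c = 1ℚ ℚ.- d
  instance
    c≥0 : ℚ.NonNegative c
    c≥0 = ℚ.nonNegative (ℚₚ.≤-trans (ℚₚ.≤-reflexive (sym (ℚₚ.+-inverseʳ d)))
        (ℚₚ.+-monoˡ-≤ (ℚ.- d) d≤1))
  c*u : c ℚ.* ⌜ u ⌝ ≡ ⌜ b ⌝
  c*u = trans (solve 2 (λ d u → (con 1ℚ :- d) :* u := u :- d :* u) refl d ⌜ u ⌝)
    (trans (cong₂ ℚ._-_ (⌜⌝-+ a b) (density a u))
      (solve 2 (λ a b → (a :+ b) :- a := b) refl ⌜ a ⌝ ⌜ b ⌝))
  -- Edges and non-edges have the same discrepancy up to sign, so few non-edges are handled like few
  -- edges, with density 1 - d.
  complement : c ℚ.* ⌜ u′ ⌝ ℚ.- ⌜ b′ ⌝ ≡ ⌜ a′ ⌝ ℚ.- d ℚ.* ⌜ u′ ⌝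
  complement rewrite ⌜⌝-+ a′ b′ =
    solve 3 (λ d a b → (con 1ℚ :- d) :* (a :+ b) :- b := a :- d :* (a :+ b)) refl d ⌜ a′ ⌝ ⌜ b′ ⌝
  go : e * a ≤ u ⊎ e * b ≤ u → ℚ.∣ ⌜ a′ ⌝ ℚ.- d ℚ.* ⌜ u′ ⌝ ∣ ℚ.≤ E
  go (inj₁ h) = ∣-∣≤ (⌜⌝≥0 a′) (ℚₚ.≤-trans (⌜⌝-mono a′≤a) a≤E)
    (d*≥0 u′) (ℚₚ.≤-trans (d*≤ u′≤u) (ℚₚ.≤-trans (ℚₚ.≤-reflexive (density a u)) a≤E))
    where
    a≤E : ⌜ a ⌝ ℚ.≤ E
    a≤E = scale a u h
  go (inj₂ h) = subst (λ x → ℚ.∣ x ∣ ℚ.≤ E) complement (∣-∣≤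
    (ℚₚ.≤-trans (ℚₚ.≤-reflexive (sym (ℚₚ.*-zeroʳ c))) (ℚₚ.*-monoˡ-≤-nonNeg c (⌜⌝≥0 u′)))
    (ℚₚ.≤-trans (ℚₚ.*-monoˡ-≤-nonNeg c (⌜⌝-mono u′≤u)) (ℚₚ.≤-trans (ℚₚ.≤-reflexive c*u) b≤E))
    (⌜⌝≥0 b′) (ℚₚ.≤-trans (⌜⌝-mono b′≤b) b≤E))
    where
    b≤E : ⌜ b ⌝ ℚ.≤ E
    b≤E = scale b u h

-- Discrepancy of nearly homogeneous triples

∫-⊑ : {Z Z′ : Fin n → Bool} {f g : Fin n → ℕ} → Z ⊑ Z′ → (∀ z → T (Z z) → f z ≤ g z) → ∫ Z f ≤
    ∫ Z′ g
∫-⊑ {Z = Z} {Z′} {f} {g} sub f≤g = ≤-trans (∫-mono f≤g) (≤-trans (≤-reflexive (∫-def Z g))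
  (≤-trans (∑-mono λ z → *-monoˡ-≤ (g z) (𝟙-mono (Z z) (Z′ z) (sub z)))
      (≤-reflexive (sym (∫-def Z′ g)))))

triples-mono : {X Y Z X′ Y′ Z′ : Fin n → Bool} {f g : Fin n → Fin n → Fin n → ℕ} →
  X ⊑ X′ → Y ⊑ Y′ → Z ⊑ Z′ → (∀ x y z → T (X x) → T (Y y) → T (Z z) → f x y z ≤ g x y z) →
  ∫ X (λ x → ∫ Y λ y → ∫ Z λ z → f x y z) ≤ ∫ X′ (λ x → ∫ Y′ λ y → ∫ Z′ λ z → g x y z)
triples-mono X⊑ Y⊑ Z⊑ f≤g = ∫-⊑ X⊑ λ x Xx → ∫-⊑ Y⊑ λ y Yy → ∫-⊑ Z⊑ λ z Zz → f≤g x y z Xx Yy Zz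

⊆⇒⊑ : {X Y : Subset n} → X ⊆ Y → lookup X ⊑ lookup Y
⊆⇒⊑ {X = X} X⊆Y z p = ∈⇒T (X⊆Y (T⇒∈ X p))

module SubsetTriples {n} (X Y Z : Subset n) (F : Family n) =
  Triples (lookup X) (lookup Y) (lookup Z) (λ x y z → F (Triple x y z))

module _ (X Y Z : Subset n) (X#Y : X # Y) (Y#Z : Y # Z) (X#Z : X # Z) (F : Family n) where

  private
    G : Family n
    G = F ∩ᶠ K₃[ X , Y , Z ]

    module FT = SubsetTriples X Y Z F
    module GT = SubsetTriples X Y Z G

  card-∩-K₃ : card G ≡ GT.edgeCount
  card-∩-K₃ = trans (≤-antisym
      (card-mono λ e p → T-∧⁺ {F e ∧ K₃[ X , Y , Z ] e} p (proj₂ (T-∧⁻ (F e) p)))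
      (card-mono λ e p → proj₁ (T-∧⁻ (G e) p)))
    (card-K₃ X Y Z X#Y Y#Z X#Z G)

  edges-∩-K₃ : GT.edgeCount ≤ FT.edgeCount
  edges-∩-K₃ = triples-mono (λ _ p → p) (λ _ p → p) (λ _ p → p) λ x y z _ _ _ →
    𝟙-mono (G (Triple x y z)) _ (proj₁ ∘ T-∧⁻ (F (Triple x y z)))

  nonEdges-∩-K₃ : GT.nonEdgeCount ≤ FT.nonEdgeCount
  nonEdges-∩-K₃ = triples-mono (λ _ p → p) (λ _ p → p) (λ _ p → p) λ x y z Xx Yy Zz →
    pointwise (F (Triple x y z)) _ (⌊⌋-intro (inK₃? X Y Z (Triple x y z))
      (inK₃-intro X Y Z X#Y Y#Z X#Z (T⇒∈ X Xx) (T⇒∈ Y Yy) (T⇒∈ Z Zz)))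
    where
    pointwise : ∀ a b → T b → 𝟙 (not (a ∧ b)) ≤ 𝟙 (not a)
    pointwise true  true _ = ≤-refl
    pointwise false b    _ = ≤-refl

  ∣∣-volume : ∀ U V W → SubsetTriples.volume U V W F ≡ ∣ U ∣ * ∣ V ∣ * ∣ W ∣
  ∣∣-volume U V W = sym (cong₂ _*_ (cong₂ _*_ (∣∣≡count U) (∣∣≡count V)) (∣∣≡count W))

  vdisc₃ : ∀ {ε e} → Scale ε e → .{{_ : NonZero (∣ X ∣ * ∣ Y ∣ * ∣ Z ∣)}} →
    e * FT.edgeCount ≤ ∣ X ∣ * ∣ Y ∣ * ∣ Z ∣ ⊎ e * FT.nonEdgeCount ≤ ∣ X ∣ * ∣ Y ∣ * ∣ Z ∣ →
        Vdisc₃ ε X Y Z G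
  vdisc₃ {ε} {e} scale small = d , sym (density (card G) (∣ X ∣ * ∣ Y ∣ * ∣ Z ∣)) , bound
    where
    d : ℚ
    d = ℤ.+ card G ℚ./ (∣ X ∣ * ∣ Y ∣ * ∣ Z ∣)
    total : card G + GT.nonEdgeCount ≡ ∣ X ∣ * ∣ Y ∣ * ∣ Z ∣
    total = trans (cong (_+ GT.nonEdgeCount) card-∩-K₃) (trans GT.edges+nonEdges (∣∣-volume X Y Z))
    small′ : e * card G ≤ ∣ X ∣ * ∣ Y ∣ * ∣ Z ∣ ⊎ e * GT.nonEdgeCount ≤ ∣ X ∣ * ∣ Y ∣ * ∣ Z ∣
    small′ = [ (λ h → inj₁ (≤-trans (*-monoʳ-≤ (e) (≤-trans (≤-reflexive card-∩-K₃) edges-∩-K₃)) h))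
             , (λ h → inj₂ (≤-trans (*-monoʳ-≤ (e) nonEdges-∩-K₃) h)) ]′ small
    bound : ∀ U V W → U ⊆ X → V ⊆ Y → W ⊆ Z →
      ℚ.∣ ⌜ card (G ∩ᶠ K₃[ U , V , W ]) ⌝ ℚ.- d ℚ.* ⌜ ∣ U ∣ * ∣ V ∣ * ∣ W ∣ ⌝ ∣ ℚ.≤ ε ℚ.* ⌜ ∣ X ∣
          * ∣ Y ∣ * ∣ Z ∣ ⌝
    bound U V W U⊆X V⊆Y W⊆Z = discrepancy {ε} {e} scale total
      (trans (cong (_+ SubsetTriples.nonEdgeCount U V W G)
          (card-K₃ U V W (λ u v → X#Y (U⊆X u) (V⊆Y v)) (λ v w → Y#Z (V⊆Y v) (W⊆Z w))
              (λ u w → X#Z (U⊆X u) (W⊆Z w)) G))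
        (trans (SubsetTriples.edges+nonEdges U V W G) (∣∣-volume U V W)))
      (card-mono λ e p → proj₁ (T-∧⁻ (G e) p))
      (triples-mono (⊆⇒⊑ U⊆X) (⊆⇒⊑ V⊆Y) (⊆⇒⊑ W⊆Z) λ _ _ _ _ _ _ → ≤-refl)
      small′

  module _ (F′ : Family n) where

    private
      module F′T = SubsetTriples X Y Z F′
      module DT  = SubsetTriples X Y Z (F △ᶠ F′)

    edges-△ : FT.edgeCount ≤ F′T.edgeCount + DT.edgeCount
    edges-△ = ≤-trans (triples-mono (λ _ p → p) (λ _ p → p) (λ _ p → p) λ x y z _ _ _ →
        pointwise (F (Triple x y z)) (F′ (Triple x y z)))
      (≤-reflexive (F′T.triples-+ (λ x y z → 𝟙 (F′ (Triple x y z)))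
          (λ x y z → 𝟙 ((F △ᶠ F′) (Triple x y z)))))
      where
      pointwise : ∀ a b → 𝟙 a ≤ 𝟙 b + 𝟙 (a xor b)
      pointwise false b     = z≤n
      pointwise true  true  = ≤-refl
      pointwise true  false = ≤-refl

    nonEdges-△ : FT.nonEdgeCount ≤ F′T.nonEdgeCount + DT.edgeCount
    nonEdges-△ = ≤-trans (triples-mono (λ _ p → p) (λ _ p → p) (λ _ p → p) λ x y z _ _ _ →
        pointwise (F (Triple x y z)) (F′ (Triple x y z)))
      (≤-reflexive (F′T.triples-+ (λ x y z → 𝟙 (not (F′ (Triple x y z))))
          (λ x y z → 𝟙 ((F △ᶠ F′) (Triple x y z)))))
      where
      pointwise : ∀ a b → 𝟙 (not a) ≤ 𝟙 (not b) + 𝟙 (a xor b)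
      pointwise true  b     = z≤n
      pointwise false true  = ≤-refl
      pointwise false false = ≤-refl

    △-card : DT.edgeCount ≤ card (F △ᶠ F′)
    △-card = ≤-trans (≤-reflexive (sym (card-K₃ X Y Z X#Y Y#Z X#Z (F △ᶠ F′))))
      (card-mono λ e → proj₁ ∘ T-∧⁻ ((F △ᶠ F′) e))

    -- Half of the error is left to F′ and half to the symmetric difference; the same argument
    -- serves edges and non-edges.
    homogeneous-△ : ∀ e {v} → 2 * e * card (F △ᶠ F′) ≤ v →
      2 * e * F′T.edgeCount ≤ v ⊎ 2 * e * F′T.nonEdgeCount ≤ v →
      e * FT.edgeCount ≤ v ⊎ e * FT.nonEdgeCount ≤ v
    homogeneous-△ e {v} close = [ (λ h → inj₁ (half edges-△ h)) ,
        (λ h → inj₂ (half nonEdges-△ h)) ]′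
      where
      half : ∀ {a b} → a ≤ b + DT.edgeCount → 2 * e * b ≤ v → e * a ≤ v
      half {a} {b} a≤ h = *-cancelˡ-≤ 2 (begin
        2 * (e * a)                              ≡⟨ *-assoc 2 e a ⟨
        2 * e * a                                ≤⟨ *-monoʳ-≤ (2 * e)
            (≤-trans a≤ (+-monoʳ-≤ b △-card)) ⟩
        2 * e * (b + card (F △ᶠ F′))             ≡⟨ *-distribˡ-+ (2 * e) b _ ⟩
        2 * e * b + 2 * e * card (F △ᶠ F′)       ≤⟨ +-mono-≤ h close ⟩
        v + v                    ≡⟨ cong (v +_) (+-identityʳ v) ⟨
        2 * v                            ∎)
        where open ≤-Reasoning

-- From labellings to equipartitions

⊑tabulate : (Z : Fin n → Bool) → Z ⊑ lookup (tabulate Z)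
⊑tabulate Z z = subst T (sym (lookup∘tabulate Z z))

tabulate⊑ : (Z : Fin n → Bool) → lookup (tabulate Z) ⊑ Z
tabulate⊑ Z z = subst T (lookup∘tabulate Z z)

∣tabulate∣ : (Z : Fin n → Bool) → ∣ tabulate Z ∣ ≡ count Z
∣tabulate∣ Z = trans (∣∣≡count (tabulate Z)) (≤-antisym (count-mono (tabulate⊑ Z))
    (count-mono (⊑tabulate Z)))

module _ (P : Fin n → Fin t) where

  class : Fin t → Subset n
  class i = tabulate (fibre P i)

  ∈-class : ∀ {z i} → z ∈ class i → P z ≡ i
  ∈-class {z} {i} z∈ = ⌊⌋-elim (P z ≟ᶠ i) (tabulate⊑ (fibre P i) z (∈⇒T z∈))

  class-disjoint : ∀ {i j} → i ≢ j → class i # class j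
  class-disjoint i≢j z∈i z∈j = i≢j (trans (sym (∈-class z∈i)) (∈-class z∈j))

  toEquipartition : ∀ {s} → 1 ≤ s → Balanced s P → Equipartition n t
  toEquipartition {s} s≥1 bal = record
    { part     = class
    ; nonempty = λ i → let z , p = ∃-of-count (fibre P i) (≤-trans s≥1 (proj₁ (bal i))) in
        z , T⇒∈ (class i) (⊑tabulate (fibre P i) z p)
    ; disjoint = λ i j i≢j (z , z∈) → let z∈i , z∈j = x∈p∩q⁻ (class i) (class j) z∈ in class-disjoint i≢j z∈i z∈j
    ; cover    = λ x → P x , T⇒∈ (class (P x)) (⊑tabulate (fibre P (P x)) x
        (⌊⌋-intro (P x ≟ᶠ P x) refl))
    ; balanced = λ i j → ≤-trans (≤-reflexive (∣tabulate∣ (fibre P i))) (≤-trans (proj₂ (bal i))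
        (s≤s (≤-trans (proj₁ (bal j)) (≤-reflexive (sym (∣tabulate∣ (fibre P j)))))))
    }

module _ {n} (F : Family n) (K e t₀ : ℕ) .{{_ : NonZero e}} (n>0 : 0 < n)
  (noTree : ∀ x → ¬ Tree (λ y z → F (Triple x y z)) full K full) where

  open Parameters K e t₀

  private
    E : Fin n → Fin n → Fin n → Bool
    E x y z = F (Triple x y z)

  open Iteration n>0 E (λ x y z → cong F (Triple-swap₁₂ x y z)) noTree using (bad?)
  open Slices E (λ x y z → cong F (Triple-swap₁₂ x y z)) K noTree using (splitting)

  module _ (P : Fin n → Fin t) (s : ℕ) (bal : Balanced s P) where

    splitting≤ : ∀ {i j} → ¬ T ⌊ bad? P s i j ⌋ → ∀ y →
      12 * e * splitting P i j y ≤ count (fibre P i) * count (fibre P j)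
    splitting≤ {i} {j} good y = ≤-trans (≤-reflexive
        (cong (_* splitting P i j y) (sym threshold-def)))
      (≤-trans (<⇒≤ (≰⇒> λ h → good (⌊⌋-intro (bad? P s i j) (y , h))))
          (*-mono-≤ (proj₁ (bal i)) (proj₁ (bal j))))

    -- Changing z, y or x is controlled by averaging over X, X or Y respectively, that is, by the
    -- ordered pairs (X , Z), (X , Y) and (Y , X). The vertex that remains fixed plays the splitter.
    homogeneous : ∀ i j k → ¬ T ⌊ bad? P s i k ⌋ → ¬ T ⌊ bad? P s i j ⌋ → ¬ T ⌊ bad? P s j i ⌋ →
      2 * e * SubsetTriples.edgeCount (class P i) (class P j) (class P k) F ≤
          ∣ class P i ∣ * ∣ class P j ∣ * ∣ class P k ∣
      ⊎ 2 * e * SubsetTriples.nonEdgeCount (class P i) (class P j) (class P k) F ≤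
          ∣ class P i ∣ * ∣ class P j ∣ * ∣ class P k ∣
    homogeneous i j k good-ik good-ij good-ji =
      [ (λ h → inj₁ (convert (triples-mono (tabulate⊑ X) (tabulate⊑ Y)
          (tabulate⊑ Z) λ _ _ _ _ _ _ → ≤-refl) h))
      , (λ h → inj₂ (convert (triples-mono (tabulate⊑ X) (tabulate⊑ Y)
          (tabulate⊑ Z) λ _ _ _ _ _ _ → ≤-refl) h))
      ]′ (⊓-small e edgeCount nonEdgeCount edges+nonEdges (edges*nonEdges≤ (12 * e)
        (splitting≤ good-ik)
        (λ z → ≤-trans (*-monoʳ-≤ (12 * e) (∫-mono λ x _ → minority-cong Y λ y → cong F
            (Triple-swap₂₃ x y z))) (splitting≤ good-ij z))
        (λ z → ≤-trans (*-monoʳ-≤ (12 * e) (∫-mono λ y _ → minority-cong X λ x → cong F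
          (trans (Triple-swap₁₂ x y z) (Triple-swap₂₃ y x z)))) (splitting≤ good-ji z))))
      where
      X Y Z : Fin n → Bool
      X = fibre P i
      Y = fibre P j
      Z = fibre P k
      open Triples X Y Z E
      convert : ∀ {a b} → a ≤ b → 2 * e * b ≤ volume → 2 * e * a ≤
          ∣ class P i ∣ * ∣ class P j ∣ * ∣ class P k ∣
      convert a≤b h = ≤-trans (*-monoʳ-≤ (2 * e) a≤b) (≤-trans h (≤-reflexive
        (sym (cong₂ _*_ (cong₂ _*_ (∣tabulate∣ X) (∣tabulate∣ Y)) (∣tabulate∣ Z)))))

-- Transfer to close 3-graphs, and the theorem

size≥1 : ∀ {n t} s → 0 < n → n ≤ 2 * (t * s) → 1 ≤ s
size≥1 {n} {t} zero    n>0 n≤ = contradiction (≤-trans n>0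
    (≤-trans n≤ (≤-reflexive (cong (2 *_) (*-zeroʳ t))))) λ ()
size≥1         (suc s) n>0 n≤ = s≤s z≤n

-- With at most τ parts, s is at least n / 2τ, so a triple of parts has volume at least n³ / 8τ³. A
-- number of changed edges that is tiny against n³ is then small against every such volume.
closeness : ∀ e τ c {n t s v} .{{_ : NonZero τ}} → n ≤ 2 * (t * s) → t ≤ τ → s * s * s ≤ v →
  8 * (τ * τ * τ) * (2 * e) * c ≤ n ^ 3 → 2 * e * c ≤ v
closeness e τ c {n} {t} {s} {v} n≤ t≤ s³≤ h = *-cancelˡ-≤
    (8 * (τ * τ * τ)) {{m*n≢0 8 (τ * τ * τ) {{_}} {{m*n≢0 (τ * τ) τ {{m*n≢0 τ τ}}}}}} (begin
  8 * (τ * τ * τ) * (2 * e * c)      ≡⟨ *-assoc (8 * (τ * τ * τ)) (2 * e) c ⟨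
  8 * (τ * τ * τ) * (2 * e) * c      ≤⟨ h ⟩
  n ^ 3                              ≤⟨ ^-monoˡ-≤ 3 (≤-trans n≤ (*-monoʳ-≤ 2 (*-monoˡ-≤ s t≤))) ⟩
  (2 * (τ * s)) ^ 3                  ≡⟨ lemma τ s ⟩
  8 * (τ * τ * τ) * (s * s * s)      ≤⟨ *-monoʳ-≤ (8 * (τ * τ * τ)) s³≤ ⟩
  8 * (τ * τ * τ) * v                ∎)
  where
  open ≤-Reasoning
  lemma : ∀ τ s → 2 * (τ * s) * (2 * (τ * s) * (2 * (τ * s) * 1)) ≡ 8 * (τ * τ * τ) * (s * s * s)
  lemma = solve-∀

module Conclusion (K e t₀ τ : ℕ) .{{_ : NonZero e}} .{{_ : NonZero τ}} (ε : ℚ) (scale : Scale ε e)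
  (bound≤ : Parameters.totalBound K e t₀ ≤ τ) {n} (n>0 : 0 < n)
  (H H′ : ThreeGraph n) (noTree : ∀ x → ¬ Tree (λ y z → edges H′ (Triple x y z)) full K full)
  (close : 8 * (τ * τ * τ) * (2 * e) * card (edges H △ᶠ edges H′) ≤ n ^ 3)
  (partition : Parameters.Iteration.GoodPartition K e t₀ n>0 (λ x y z → edges H′ (Triple x y z))
    (λ x y z → cong (edges H′) (Triple-swap₁₂ x y z)) noTree (Parameters.totalBound K e t₀)) where

  open Parameters K e t₀
  open Iteration n>0 (λ x y z → edges H′ (Triple x y z)) (λ x y z → cong (edges H′) (Triple-swap₁₂ x y z)) noTree

  open GoodPartition partition renaming (labelling to P)
  open Equitable equitable renaming (size to s)

  private
    s≥1 : 1 ≤ s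
    s≥1 = size≥1 {t = parts} s n>0 n≤
    badᵇ : Fin parts → Fin parts → Bool
    badᵇ i j = ⌊ bad? P s i j ⌋

  few-pairs : ⌜ card (edges (PairSet.pairs badᵇ)) ⌝ ℚ.≤ ε ℚ.* ⌜ parts ^ 2 ⌝
  few-pairs = scale _ (parts ^ 2) (≤-trans (*-monoʳ-≤ e (PairSet.card-pairs badᵇ))
    (≤-trans few-bad (≤-reflexive (cong (parts *_) (sym (*-identityʳ parts))))))

  regular : ∀ i j l → i ≢ j → j ≢ l → i ≢ l →
    Pair i j ∉ᶠ edges (PairSet.pairs badᵇ) → Pair i l ∉ᶠ edges (PairSet.pairs badᵇ) →
    Vdisc₃ ε (class P i) (class P j) (class P l) (edges H ∩ᶠ K₃[ class P i , class P j ,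
        class P l ])
  regular i j l i≢j j≢l i≢l ij il = vdisc₃ (class P i) (class P j) (class P l)
    (class-disjoint P i≢j) (class-disjoint P j≢l) (class-disjoint P i≢l) (edges H) {ε} {e} scale
    {{ℕ.>-nonZero (≤-trans (*-mono-≤ (*-mono-≤ s≥1 s≥1) s≥1) volume≥)}}
    (homogeneous-△ (class P i) (class P j) (class P l)
      (class-disjoint P i≢j) (class-disjoint P j≢l) (class-disjoint P i≢l) (edges H) (edges H′) e
      (closeness e τ (card (edges H △ᶠ edges H′)) n≤ (≤-trans parts≤ bound≤) volume≥ close)
      (homogeneous (edges H′) K e t₀ n>0 noTree P s size-bal i j l
        (proj₁ (PairSet.Pair∉ badᵇ i l i≢l il)) (proj₁ (PairSet.Pair∉ badᵇ i j i≢j ij))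
            (proj₂ (PairSet.Pair∉ badᵇ i j i≢j ij))))
    where
    ∣class∣≥ : ∀ i → s ≤ ∣ class P i ∣
    ∣class∣≥ i = ≤-trans (proj₁ (size-bal i)) (≤-reflexive (sym (∣tabulate∣ (fibre P i))))
    volume≥ : s * s * s ≤ ∣ class P i ∣ * ∣ class P j ∣ * ∣ class P l ∣
    volume≥ = *-mono-≤ (*-mono-≤ (∣class∣≥ i) (∣class∣≥ j)) (∣class∣≥ l)

  conclusion : ∃[ t ] (t₀ ≤ t × t ≤ Parameters.totalBound K e t₀) ×
    (Σ[ P ∈ Equipartition n t ] Σ[ S ∈ Uniform 2 t ]
      ⌜ card (edges S) ⌝ ℚ.≤ ε ℚ.* ⌜ t ^ 2 ⌝ ×
      (∀ i j k → i ≢ j → j ≢ k → i ≢ k →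
        Pair i j ∉ᶠ edges S → Pair j k ∉ᶠ edges S → Pair i k ∉ᶠ edges S →
        Vdisc₃ ε (part P i) (part P j) (part P k)
          (edges H ∩ᶠ K₃[ part P i , part P j , part P k ])))
  conclusion = parts , (t₀≤parts , parts≤) , toEquipartition P s≥1 size-bal , PairSet.pairs badᵇ ,
      few-pairs ,
    λ i j k i≢j j≢k i≢k ij _ ik → regular i j k i≢j j≢k i≢k ij ik

proposition2p45 : ∀ {ℓ ℓ′ : Level} (𝓗 : Property ℓ) → Hereditary 𝓗 →
    (Σ[ 𝓗′ ∈ Property ℓ′ ] Hereditary 𝓗′ × SlicewiseStable 𝓗′ × 𝓗 IsCloseTo 𝓗′) →
    AdmitsBinaryVdisc₃Error 𝓗
proposition2p45 𝓗 _ (𝓗′ , _ , (k , stable) , close) ε ε>0 t₀ _ =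
  totalBound , τ + N₀ , λ {n} H H∈𝓗 N≤n →
    let H′ , H′∈𝓗′ , H-close = approximate H H∈𝓗 (≤-trans (m≤n+m N₀ τ) N≤n)
        τ≤n = ≤-trans (m≤m+n τ N₀) N≤n
        -- A tall splitting tree in the slice of x yields a half-graph there, which slicewise
        -- stability forbids with x as the common vertex.
        noTree = λ x tree → stable H′ H′∈𝓗′ (x , Ladder⇒HalfGraph (Tree⇒Ladder _ k tree))
    in Conclusion.conclusion (treeHeight k) e t₀ τ ε (⌜⌝-≤-* ε ε>0) (n≤1+n totalBound)
         (≤-trans (s≤s z≤n) τ≤n) H H′ noTree (≤-*-⌜⌝ D _ (n ^ 3) H-close)
         (Iteration.goodPartition _ _ _ _ (≤-trans (n≤1+n totalBound) τ≤n))
  where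
  e : ℕ
  e = ↧ₙ ε
  open Parameters (treeHeight k) e t₀ using (totalBound; module Iteration)
  -- The closeness δ = 1 / D is fixed in terms of the bound on the number of parts, before any
  -- 3-graph is given. The successor makes τ positive, and thereby n.
  τ D : ℕ
  τ = suc totalBound
  D = 8 * (τ * τ * τ) * (2 * e)
  instance
    D≢0 : NonZero D
    D≢0 = m*n≢0 (8 * (τ * τ * τ)) (2 * e) {{m*n≢0 8 (τ * τ * τ)}} {{m*n≢0 2 e}}
  N₀ : ℕ
  N₀ = proj₁ (close (ℤ.+ 1 ℚ./ D) (1/>0 D))
  approximate = proj₂ (close (ℤ.+ 1 ℚ./ D) (1/>0 D))
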